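{- Let $d \geq 54000$ be an integer and let $G=(V,E)$ be a finite simple $d$-regular graph. Then $G$ is decomposable to $4$ locally irregular subgraphs; that is, the edge set can be partitioned as $E = E_1\cup E_2\cup E_3\cup E_4$ (with the $E_i$ pairwise disjoint) such that for every $i\in\{1,2,3,4\}$ the graph $G_i=(V,E_i)$ is locally irregular.
   Context: All graphs are simple and finite. A graph $G=(V,E)$ is locally irregular if adjacent vertices have distinct degrees, i.e. $d_G(u)\neq d_G(v)$ for every edge $uv\in E$, where $d_G(v)$ denotes the degree of $v$ in $G$. A graph $G=(V,E)$ is decomposable to $k$ locally irregular subgraphs if its edge set can be partitioned into $k$ subsets $E=E_1\cup E_2\cup\ldots\cup E_k$ such that the subgraph $G_i=(V,E_i)$ is locally irregular for $i=1,2,\ldots,k$. -}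

module Defs where

open import Data.Fin.Base using (Fin)
open import Data.Nat.Base using (ℕ)
open import Data.Product.Base using (Σ-syntax; ∃-syntax)
open import Data.Vec.Base using (allFin; count)
open import Level using (0ℓ)
open import Relation.Binary.Core using (Rel; _⇒_)
open import Relation.Binary.Definitions using (Decidable; Irreflexive; Symmetric)
open import Relation.Binary.PropositionalEquality.Core using (_≡_; _≢_)
open import Relation.Nullary.Negation.Core using (¬_)

record Graph (n : ℕ) : Set₁ where
  field
    Adj    : Rel (Fin n) 0ℓ
    adj?   : Decidable Adj
    sym    : Symmetric Adj
    irrefl : Irreflexive _≡_ Adj

  degree : Fin n → ℕ
  degree v = count (adj? v) (allFin n)

open Graph public using (Adj; degree)

Regular : ∀ {n : ℕ} → ℕ → Graph n → Set
Regular d G = ∀ v → degree G v ≡ d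

LocallyIrregular : ∀ {n : ℕ} → Graph n → Set
LocallyIrregular G = ∀ u v → Adj G u v → degree G u ≢ degree G v

-- Each edge class Eᵢ is represented by the spanning subgraph (V , Eᵢ).
-- Classes may be empty.
record EdgePartition {n : ℕ} (k : ℕ) (G : Graph n) : Set₁ where
  field
    part     : Fin k → Graph n
    subgraph : ∀ i → Adj (part i) ⇒ Adj G
    covers   : ∀ u v → Adj G u v → ∃[ i ] Adj (part i) u v
    disjoint : ∀ i j → i ≢ j → ∀ u v → Adj (part i) u v → ¬ Adj (part j) u v

Decomposable : ∀ {n : ℕ} → ℕ → Graph n → Set₁
Decomposable k G =
  Σ[ P ∈ EdgePartition k G ] (∀ i → LocallyIrregular (EdgePartition.part P i))

{-# OPTIONS --safe #-}

-- Colour the vertices by triples of residues modulo k, where k³ is just above 2d, and add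
-- the sum of the triple as a fourth key.  A colouring that is locally optimal for a cost
-- charging 1 for each shared key and 4k² for equal colours is proper, and at every vertex
-- fewer than 4k² edges join vertices that share a key.  It then suffices that the degree of
-- v in class i is 7 times its i-th key modulo 7k, up to an error of absolute value at most 1
-- for the first three classes, hence at most 3 for the last one since G is regular, and that
-- an edge goes to a class in which the keys of its ends differ.
--
-- One such class is chosen inside a maximum cut (X, W), whose degrees are large compared
-- with M = 7k.  Among the subgraphs whose degrees at X lie in the prescribed residue classes,
-- two consecutive members of the class being allowed at each vertex, take one that minimises
-- the sum over W of the squared deviations from the target degrees.  If some deviation were
-- at least 2, consider the vertices of W reached from there by alternating paths.  Moving
-- an edge along such a path rules out small deviations on this set, and comparison with a
-- fractional subgraph meeting all targets yields a vertex of X that has M edges into the set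
-- and may drop them all, which lowers the sum; negative deviations are dual.
module Submission where

open import Defs
open import Data.Bool.Base using (Bool; true; false; _∧_; _∨_; _xor_; not; if_then_else_)
open import Data.Bool.Properties using (∨-comm; ∨-identityʳ) renaming (_≟_ to _≟ᵇ_)
open import Data.Empty using (⊥-elim)
open import Data.Fin.Base using (Fin; zero; suc; toℕ)
open import Data.Fin.Patterns using (0F; 1F; 2F; 3F)
open import Data.Fin.Properties using (_≟_; any?; suc-injective; toℕ<n; toℕ-injective)
open import Data.List.Base using (_∷_; [])
open import Data.Nat.Base hiding (_%_; _/_; equal)
open import Data.Nat.DivMod using (m≡m%n+[m/n]*n; [m+kn]%n≡m%n; m<n⇒m%n≡m; m%n<n; _%_; _/_)
open import Data.Nat.Properties hiding (suc-injective) renaming (_≟_ to _≟ℕ_)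
open import Data.Nat.Tactic.RingSolver using (solve; solve-∀)
open import Data.Product.Base using (_×_; _,_; ∃; proj₁; proj₂)
open import Data.Sum.Base using (_⊎_; inj₁; inj₂)
open import Data.Vec.Base using (tabulate; count)
open import Function.Base using (_∘_)
open import Relation.Binary.PropositionalEquality
open import Relation.Nullary
open import Algebra.Properties.Semiring.Sum +-*-semiring

private variable
  m n : ℕ

-- Linear arithmetic by certificate: A ≤ B is a combination of the
-- hypotheses, c the slack, and the equation is left to the ring solver.
linear : ∀ {A B l r} c → A ≤ B → l + B + c ≡ r + A → l ≤ r
linear {A} {B} {l} {r} c A≤B eq = +-cancelʳ-≤ A l r
  (≤-trans (+-monoʳ-≤ l A≤B) (≤-trans (m≤m+n (l + B) c) (≤-reflexive eq)))

infixr 6 _⊕_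
_⊕_ : ∀ {a b c d} → a ≤ b → c ≤ d → a + c ≤ b + d
_⊕_ = +-mono-≤

infixr 7 _⊛_
_⊛_ : ∀ k {a b} → a ≤ b → k * a ≤ k * b
k ⊛ p = *-monoʳ-≤ k p

-- Finite sums and Boolean counts.

⟦_⟧ : Bool → ℕ
⟦ false ⟧ = 0
⟦ true  ⟧ = 1

⟦⟧≤1 : ∀ b → ⟦ b ⟧ ≤ 1
⟦⟧≤1 false = z≤n
⟦⟧≤1 true  = ≤-refl

# : (Fin n → Bool) → ℕ
# f = sum (λ i → ⟦ f i ⟧)

∧-true : ∀ {a b} → a ∧ b ≡ true → a ≡ true × b ≡ true
∧-true {true} {true} _ = refl , refl

false≢true : ∀ {b} → b ≡ false → b ≢ true
false≢true refl ()

sum-mono-≤ : {f g : Fin n → ℕ} → (∀ i → f i ≤ g i) → sum f ≤ sum g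
sum-mono-≤ {zero}  h = z≤n
sum-mono-≤ {suc n} h = h zero ⊕ sum-mono-≤ (h ∘ suc)

sum-mono-< : {f g : Fin n → ℕ} → (∀ i → f i ≤ g i) → ∀ j → f j < g j → sum f < sum g
sum-mono-< h zero    f<g = +-mono-<-≤ f<g (sum-mono-≤ (h ∘ suc))
sum-mono-< h (suc j) f<g = +-mono-≤-< (h zero) (sum-mono-< (h ∘ suc) j f<g)

sum-<⇒∃ : (f g : Fin n → ℕ) → sum f < sum g → ∃ λ i → f i < g i
sum-<⇒∃ f g f<g with any? (λ i → f i <? g i)
... | yes p = p
... | no ¬p = ⊥-elim (<⇒≱ f<g (sum-mono-≤ (λ i → ≮⇒≥ (λ q → ¬p (i , q)))))

term≤sum : (f : Fin n → ℕ) → ∀ i → f i ≤ sum f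
term≤sum f zero    = m≤m+n _ _
term≤sum f (suc i) = ≤-trans (term≤sum (f ∘ suc) i) (m≤n+m _ _)

sum-zero : {f : Fin n → ℕ} → (∀ i → f i ≡ 0) → sum f ≡ 0
sum-zero {zero}  h = refl
sum-zero {suc n} h = cong₂ _+_ (h zero) (sum-zero (h ∘ suc))

sum-const : ∀ n c → sum {n} (λ _ → c) ≡ n * c
sum-const zero    c = refl
sum-const (suc n) c = cong (c +_) (sum-const n c)

sum-scale : ∀ c (f : Fin n → ℕ) → sum (λ i → c * f i) ≡ c * sum f
sum-scale c f = sym (*-distribˡ-sum c f)

sum-+ : (f g : Fin n → ℕ) → sum (λ i → f i + g i) ≡ sum f + sum g
sum-+ = ∑-distrib-+

sum-update : {f g : Fin n → ℕ} → ∀ i → (∀ j → j ≢ i → f j ≡ g j) → sum f + g i ≡ sum g + f i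
sum-update {f = f} {g} zero    h
  rewrite sum-cong-≗ {x = f ∘ suc} {y = g ∘ suc} (λ j → h (suc j) (λ ()))
  = shuffle (f zero) (sum (g ∘ suc)) (g zero)
  where
  shuffle : ∀ x y z → x + y + z ≡ z + y + x
  shuffle = solve-∀
sum-update {f = f} {g} (suc i) h
  with sum-update {f = f ∘ suc} {g ∘ suc} i (λ j j≢i → h (suc j) (j≢i ∘ suc-injective))
... | eq rewrite h zero (λ ()) | +-assoc (g zero) (sum (f ∘ suc)) (g (suc i))
  | +-assoc (g zero) (sum (g ∘ suc)) (f (suc i)) = cong (g zero +_) eq

-- The two values are changed one at a time, through `mid`. Old and new values stand on opposite
-- sides of the equation, so that no subtraction occurs.
sum-update₂ : {f g : Fin n → ℕ} → ∀ i k → i ≢ k → (∀ j → j ≢ i → j ≢ k → f j ≡ g j) →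
              sum f + (g i + g k) ≡ sum g + (f i + f k)
sum-update₂ {n} {f} {g} i k i≢k h = +-cancelʳ-≡ (sum mid) _ _ (begin
  sum f + (g i + g k) + sum mid      ≡⟨ shuffle (sum f) (g i) (g k) (sum mid) ⟩
  (sum f + g i) + (sum mid + g k)    ≡⟨ cong₂ _+_ first second ⟩
  (sum mid + f i) + (sum g + f k)    ≡⟨ shuffle′ (sum mid) (f i) (sum g) (f k) ⟩
  sum g + (f i + f k) + sum mid      ∎)
  where
  open ≡-Reasoning
  mid : Fin n → ℕ
  mid j = if does (j ≟ i) then g j else f j
  mid-i : mid i ≡ g i
  mid-i with i ≟ i
  ... | yes _ = refl
  ... | no ¬p = ⊥-elim (¬p refl)
  mid-≢ : ∀ j → j ≢ i → mid j ≡ f j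
  mid-≢ j j≢i with j ≟ i
  ... | yes p = ⊥-elim (j≢i p)
  ... | no _  = refl
  mid-k : ∀ j → j ≢ k → mid j ≡ g j
  mid-k j j≢k with j ≟ i
  ... | yes _ = refl
  ... | no j≢i = h j j≢i j≢k
  first : sum f + g i ≡ sum mid + f i
  first = trans (cong (sum f +_) (sym mid-i)) (sum-update i (λ j j≢i → sym (mid-≢ j j≢i)))
  second : sum mid + g k ≡ sum g + f k
  second = trans (sum-update k mid-k) (cong (sum g +_) (mid-≢ k (i≢k ∘ sym)))
  shuffle : ∀ a b c d → a + (b + c) + d ≡ (a + b) + (d + c)
  shuffle = solve-∀
  shuffle′ : ∀ a b c d → (a + b) + (c + d) ≡ c + (b + d) + a
  shuffle′ = solve-∀

#-mono : {f g : Fin n → Bool} → (∀ i → f i ≡ true → g i ≡ true) → # f ≤ # g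
#-mono {f = f} {g} h = sum-mono-≤ λ i → pointwise i
  where
  pointwise : ∀ i → ⟦ f i ⟧ ≤ ⟦ g i ⟧
  pointwise i with f i in eq
  ... | false = z≤n
  ... | true  rewrite h i eq = ≤-refl

#≤n : (f : Fin n → Bool) → # f ≤ n
#≤n {n} f = ≤-trans (sum-mono-≤ (λ i → ⟦⟧≤1 (f i))) (≤-reflexive (trans (sum-const n 1) (*-identityʳ n)))

#>0⇒∃ : (f : Fin n → Bool) → 0 < # f → ∃ λ i → f i ≡ true
#>0⇒∃ {n} f 0<#f with sum-<⇒∃ (λ _ → 0) (λ i → ⟦ f i ⟧)
                         (subst (_< # f) (sym (sum-zero {n} {λ _ → 0} (λ _ → refl))) 0<#f)
... | i , 0<fi with f i in eq
...   | true = i , eq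

#-unique : (f : Fin n → Bool) → (∀ i j → f i ≡ true → f j ≡ true → i ≡ j) → # f ≤ 1
#-unique {zero}  f h = z≤n
#-unique {suc n} f h with f zero in eq
... | true  = s≤s (≤-reflexive (sum-zero rest))
  where
  rest : ∀ i → ⟦ f (suc i) ⟧ ≡ 0
  rest i with f (suc i) in eq′
  ... | false = refl
  ... | true  with () ← h zero (suc i) eq eq′
... | false = #-unique (f ∘ suc) (λ i j p q → suc-injective (h (suc i) (suc j) p q))

choose : (f : Fin n → Bool) → ∀ m → m ≤ # f →
         ∃ λ g → (∀ i → g i ≡ true → f i ≡ true) × # g ≡ m
choose {zero} f zero z≤n = f , (λ _ p → p) , refl
choose {suc n} f zero _ = (λ _ → false) , (λ _ ()) , sum-zero {suc n} {λ _ → 0} (λ _ → refl)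
choose {suc n} f (suc m) m<#f with f zero in eq
... | true with choose (f ∘ suc) m (s≤s⁻¹ m<#f)
...   | g , g⊆f , #g = g′ , g′⊆f , cong suc #g
  where
  g′ : Fin (suc n) → Bool
  g′ zero    = true
  g′ (suc i) = g i
  g′⊆f : ∀ i → g′ i ≡ true → f i ≡ true
  g′⊆f zero    _ = eq
  g′⊆f (suc i) p = g⊆f i p
choose {suc n} f (suc m) m<#f | false with choose (f ∘ suc) (suc m) m<#f
...   | g , g⊆f , #g = g′ , g′⊆f , #g
  where
  g′ : Fin (suc n) → Bool
  g′ zero    = false
  g′ (suc i) = g i
  g′⊆f : ∀ i → g′ i ≡ true → f i ≡ true
  g′⊆f zero    ()
  g′⊆f (suc i) p = g⊆f i p

-- Descent, local optima and reachability.

-- Minimisation as a terminating search: a state that is not yet good yields one of smaller measure.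
-- The fuel `k` stays strictly above `μ`, so it cannot run out.
descend : ∀ {S Good : Set} (μ : S → ℕ) → (∀ s → Good ⊎ (∃ λ s′ → μ s′ < μ s)) → S → Good
descend {S} {Good} μ step s = go (suc (μ s)) s ≤-refl
  where
  go : ∀ k s → μ s < k → Good
  go (suc k) s μs<k with step s
  ... | inj₁ good        = good
  ... | inj₂ (s′ , lt) = go k s′ (≤-trans lt (s≤s⁻¹ μs<k))

replace : ∀ {A : Set} → (Fin n → A) → Fin n → A → Fin n → A
replace f i a j = if does (j ≟ i) then a else f j

replace-≡ : ∀ {A : Set} (f : Fin n → A) i a → replace f i a i ≡ a
replace-≡ f i a with i ≟ i
... | yes _ = refl
... | no ¬p = ⊥-elim (¬p refl)

replace-≢ : ∀ {A : Set} (f : Fin n → A) i a {j} → j ≢ i → replace f i a j ≡ f j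
replace-≢ f i a {j} j≢i with j ≟ i
... | yes p = ⊥-elim (j≢i p)
... | no _  = refl

-- Recolouring v changes the total cost, which counts every edge from both
-- ends, by twice the change of the cost at v.
locally-optimal : {C : Set} → (∀ {P : C → Set} → (∀ γ → Dec (P γ)) → Dec (∃ P)) →
  (E : Fin n → Fin n → Bool) → (∀ u v → E u v ≡ E v u) → (∀ v → E v v ≡ false) →
  (cost : C → C → ℕ) → (∀ γ δ → cost γ δ ≡ cost δ γ) → C →
  ∃ λ (c : Fin n → C) → ∀ v γ →
    sum (λ u → ⟦ E v u ⟧ * cost (c v) (c u)) ≤ sum (λ u → ⟦ E v u ⟧ * cost γ (c u))
locally-optimal {n} {C} search E E-sym loopless cost cost-sym γ₀ = descend total step (λ _ → γ₀)
  where
  at : (Fin n → C) → Fin n → C → ℕ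
  at c v γ = sum (λ u → ⟦ E v u ⟧ * cost γ (c u))

  total : (Fin n → C) → ℕ
  total c = sum (λ v → at c v (c v))

  recolour : ∀ c v γ → total (replace c v γ) + 2 * at c v (c v) ≡ total c + 2 * at c v γ
  recolour c v γ = begin
    total c′ + 2 * at c v (c v)                                  ≡⟨ split (total c′) (at c v (c v)) ⟩
    (total c′ + at c v (c v)) + (at c v (c v) + 0)
      ≡⟨ cong₂ _+_ (trans (cong (total c′ +_) (sym sum-old)) (sym (sum-+ after old)))
                   (cong (at c v (c v) +_) (sym new-v)) ⟩
    sum (λ w → after w + old w) + (before v + new v)             ≡⟨ sum-update v elsewhere ⟩
    sum (λ w → before w + new w) + (after v + old v)
      ≡⟨ cong₂ _+_ (trans (sum-+ before new) (cong (total c +_) sum-new)) (cong₂ _+_ after-v old-v) ⟩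
    (total c + at c v γ) + (at c v γ + 0)                        ≡⟨ split (total c) (at c v γ) ⟨
    total c + 2 * at c v γ                                       ∎
    where
    open ≡-Reasoning
    c′ : Fin n → C
    c′ = replace c v γ
    -- For `w` other than `v`, both `after w + old w` and `before w + new w` contain the edge to `v`
    -- under the old colour and under the new one, so they agree. At `v` itself `old` and `new`
    -- vanish because there are no loops.
    before after old new : Fin n → ℕ
    before w = at c w (c w)
    after w = at c′ w (c′ w)
    old w = ⟦ E w v ⟧ * cost (c w) (c v)
    new w = ⟦ E w v ⟧ * cost (c w) γ
    split : ∀ a b → a + 2 * b ≡ (a + b) + (b + 0)
    split = solve-∀
    sum-old : sum old ≡ at c v (c v)
    sum-old = sum-cong-≗ λ w → cong₂ _*_ (cong ⟦_⟧ (E-sym w v)) (cost-sym (c w) (c v))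
    sum-new : sum new ≡ at c v γ
    sum-new = sum-cong-≗ λ w → cong₂ _*_ (cong ⟦_⟧ (E-sym w v)) (cost-sym (c w) γ)
    old-v : old v ≡ 0
    old-v rewrite loopless v = refl
    new-v : new v ≡ 0
    new-v rewrite loopless v = refl
    unchanged : ∀ w δ u → u ≢ v → ⟦ E w u ⟧ * cost δ (c′ u) ≡ ⟦ E w u ⟧ * cost δ (c u)
    unchanged w δ u u≢v = cong (λ ε → ⟦ E w u ⟧ * cost δ ε) (replace-≢ c v γ u≢v)
    after-v : after v ≡ at c v γ
    after-v = trans (cong (at c′ v) (replace-≡ c v γ)) (sum-cong-≗ same)
      where
      same : ∀ u → ⟦ E v u ⟧ * cost γ (c′ u) ≡ ⟦ E v u ⟧ * cost γ (c u)
      same u with u ≟ v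
      ... | yes refl rewrite loopless v = refl
      ... | no  _ = refl
    elsewhere : ∀ w → w ≢ v → after w + old w ≡ before w + new w
    elsewhere w w≢v = begin
      after w + old w          ≡⟨ cong (λ δ → at c′ w δ + old w) (replace-≢ c v γ w≢v) ⟩
      at c′ w (c w) + old w    ≡⟨ sum-update v (unchanged w (c w)) ⟩
      before w + ⟦ E w v ⟧ * cost (c w) (c′ v)
        ≡⟨ cong (λ δ → before w + ⟦ E w v ⟧ * cost (c w) δ) (replace-≡ c v γ) ⟩
      before w + new w         ∎

  step : ∀ c → (∃ λ (c : Fin n → C) → ∀ v γ → at c v (c v) ≤ at c v γ) ⊎
               (∃ λ c′ → total c′ < total c)
  step c with any? (λ v → search (λ γ → at c v γ <? at c v (c v)))
  ... | no ¬better = inj₁ (c , λ v γ → ≮⇒≥ λ lt → ¬better (v , γ , lt))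
  ... | yes (v , γ , lt) = inj₂ (replace c v γ ,
    linear 1 (≤-reflexive (recolour c v γ) ⊕ 2 ⊛ lt)
      (eq (total (replace c v γ)) (total c) (at c v γ) (at c v (c v))))
    where
    eq : ∀ t t′ a b → suc t + (t′ + 2 * a + 2 * b) + 1 ≡ t′ + (t + 2 * b + 2 * suc a)
    eq = solve-∀

-- The set grows along `T` until it is closed or meets a failure of `Q`; its complement shrinks each
-- time. `Reach` is carried along so that a failure arrives with its history, in the uses below an
-- alternating path.
saturate : {T : Fin n → Fin n → Set} → (∀ w w′ → Dec (T w w′)) →
  {Reach : Fin n → Set} → (∀ {w w′} → Reach w → T w w′ → Reach w′) →
  {Q : Fin n → Set} → (∀ w → Dec (Q w)) → ∀ s → Reach s → Q s →
  (∃ λ w → Reach w × ¬ Q w) ⊎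
  (∃ λ (R : Fin n → Bool) → R s ≡ true × (∀ w → R w ≡ true → Q w) ×
     (∀ w w′ → R w ≡ true → T w w′ → R w′ ≡ true))
saturate {n} {T} T? {Reach} extend {Q} Q? s Rs Qs = descend missing step start
  where
  State : Set
  State = ∃ λ (R : Fin n → Bool) → R s ≡ true × (∀ w → R w ≡ true → Reach w × Q w)

  missing : State → ℕ
  missing (R , _) = n ∸ # R

  insert : (R : Fin n → Bool) → ∀ w → Fin n → Bool
  insert R w = replace R w true

  insert-⊇ : ∀ R w w′ → R w′ ≡ true → insert R w w′ ≡ true
  insert-⊇ R w w′ Rw′ with w′ ≟ w
  ... | yes _ = refl
  ... | no _  = Rw′

  start : State
  start = insert (λ _ → false) s , replace-≡ (λ _ → false) s true , sound
    where
    sound : ∀ w → insert (λ _ → false) s w ≡ true → Reach w × Q w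
    sound w Rw with w ≟ s
    sound w Rw | yes refl = Rs , Qs
    sound w () | no _

  step : ∀ σ → _ ⊎ (∃ λ σ′ → missing σ′ < missing σ)
  step (R , s∈R , sound)
    with any? (λ w → any? (λ w′ → (R w ≟ᵇ true) ×-dec T? w w′ ×-dec (R w′ ≟ᵇ false)))
  ... | no closed = inj₁ (inj₂ (R , s∈R , (λ w Rw → proj₂ (sound w Rw)) , closed′))
    where
    closed′ : ∀ w w′ → R w ≡ true → T w w′ → R w′ ≡ true
    closed′ w w′ Rw Tww′ with R w′ in eq
    ... | true  = refl
    ... | false = ⊥-elim (closed (w , w′ , Rw , Tww′ , eq))
  ... | yes (w , w′ , Rw , Tww′ , ¬Rw′) with Q? w′
  ...   | no ¬Qw′ = inj₁ (inj₁ (w′ , extend (proj₁ (sound w Rw)) Tww′ , ¬Qw′))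
  ...   | yes Qw′ = inj₂ ((insert R w′ , insert-⊇ R w′ s s∈R , sound′) , larger)
    where
    sound′ : ∀ v → insert R w′ v ≡ true → Reach v × Q v
    sound′ v Rv with v ≟ w′
    ... | yes refl = extend (proj₁ (sound w Rw)) Tww′ , Qw′
    ... | no _     = sound v Rv
    #R′ : # (insert R w′) ≡ suc (# R)
    #R′ = begin
      # (insert R w′)             ≡⟨ +-identityʳ _ ⟨
      # (insert R w′) + 0         ≡⟨ cong (λ b → # (insert R w′) + ⟦ b ⟧) ¬Rw′ ⟨
      # (insert R w′) + ⟦ R w′ ⟧  ≡⟨ sum-update w′ (λ v v≢w′ → cong ⟦_⟧ (replace-≢ R w′ true v≢w′)) ⟩
      # R + ⟦ insert R w′ w′ ⟧    ≡⟨ cong (λ b → # R + ⟦ b ⟧) (replace-≡ R w′ true) ⟩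
      # R + 1                     ≡⟨ +-comm (# R) 1 ⟩
      suc (# R)                   ∎
      where open ≡-Reasoning
    larger : n ∸ # (insert R w′) < n ∸ # R
    larger = ∸-monoʳ-< (≤-reflexive (sym #R′)) (#≤n (insert R w′))

-- Bipartite subgraphs with prescribed row sums, and alternating paths.

module BipartiteSubgraph {n : ℕ} (N : Fin n → Fin n → Bool) (a b : Fin n → ℕ) (M : ℕ) where

  row col : (Fin n → Fin n → Bool) → Fin n → ℕ
  row P x = # (P x)
  col P w = # (λ x → P x w)

  -- Rows and columns are both indexed by all vertices; in the application those on the wrong side
  -- of the cut are empty. The two allowed row sums are consecutive members of a residue class
  -- modulo `M`, so a row can change only by a whole batch of `M` edges.
  Valid : (Fin n → Fin n → Bool) → Set
  Valid P = (∀ x w → P x w ≡ true → N x w ≡ true) ×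
            (∀ x → row P x ≡ a x ⊎ row P x ≡ a x + M)

  -- For d ≤ n this is (d - c)² up to an additive constant.
  potential : ℕ → ℕ → ℕ
  potential c d = d * d + 2 * c * (n ∸ d)

  Φ : (Fin n → Fin n → Bool) → ℕ
  Φ P = sum (λ w → potential (b w) (col P w))

  Improvable : (Fin n → Fin n → Bool) → Set
  Improvable P = ∃ λ P′ → Valid P′ × Φ P′ < Φ P

  -- The increment 2(d - c) + 1 of the square, with the negative term moved across.
  potential-suc : ∀ c {d} → d < n → potential c (suc d) + 2 * c ≡ potential c d + (2 * d + 1)
  potential-suc c {d} d<n rewrite +-∸-assoc 1 d<n = eq c d (n ∸ suc d)
    where
    eq : ∀ c d e → (suc d * suc d + 2 * c * e) + 2 * c ≡ (d * d + 2 * c * suc e) + (2 * d + 1)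
    eq = solve-∀

  potential-pred-< : ∀ {c d} → d < n → c ≤ d → potential c d < potential c (suc d)
  potential-pred-< {c} {d} d<n c≤d =
    linear 0 (≤-reflexive (sym (potential-suc c d<n)) ⊕ 2 ⊛ c≤d)
      (eq (potential c d) (potential c (suc d)) c d)
    where
    eq : ∀ p q c d → suc p + (q + 2 * c + 2 * d) + 0 ≡ q + (p + (2 * d + 1) + 2 * c)
    eq = solve-∀

  potential-suc-< : ∀ {c d} → d < n → d < c → potential c (suc d) < potential c d
  potential-suc-< {c} {d} d<n d<c =
    linear 0 (≤-reflexive (potential-suc c d<n) ⊕ 2 ⊛ d<c)
      (eq (potential c d) (potential c (suc d)) c d)
    where
    eq : ∀ p q c d → suc q + (p + (2 * d + 1) + 2 * c) + 0 ≡ p + (q + 2 * c + 2 * suc d)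
    eq = solve-∀

  col-replace : ∀ P x r w → col (replace P x r) w + ⟦ P x w ⟧ ≡ col P w + ⟦ r w ⟧
  col-replace P x r w = trans
    (sum-update x (λ y y≢x → cong (λ s → ⟦ s w ⟧) (replace-≢ P x r y≢x)))
    (cong (λ s → col P w + ⟦ s w ⟧) (replace-≡ P x r))

  valid-replace : ∀ P x r → Valid P → (∀ w → r w ≡ true → N x w ≡ true) →
                  # r ≡ a x ⊎ # r ≡ a x + M → Valid (replace P x r)
  valid-replace P x r (P⊆N , rows) r⊆N #r = sub , rows′
    where
    sub : ∀ y w → replace P x r y w ≡ true → N y w ≡ true
    sub y w with y ≟ x
    ... | yes refl = r⊆N w
    ... | no _     = P⊆N y w
    rows′ : ∀ y → row (replace P x r) y ≡ a y ⊎ row (replace P x r) y ≡ a y + M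
    rows′ y with y ≟ x
    ... | yes refl = #r
    ... | no _     = rows y

  module Swap (P : Fin n → Fin n → Bool) (valid : Valid P) (x i j : Fin n)
              (Pxi : P x i ≡ true) (Nxj : N x j ≡ true) (¬Pxj : P x j ≡ false) where

    without-i r : Fin n → Bool
    without-i = replace (P x) i false
    r = replace without-i j true

    swap : Fin n → Fin n → Bool
    swap = replace P x r

    i≢j : i ≢ j
    i≢j refl = false≢true ¬Pxj Pxi

    r-i : r i ≡ false
    r-i = trans (replace-≢ without-i j true i≢j) (replace-≡ (P x) i false)

    r-j : r j ≡ true
    r-j = replace-≡ without-i j true

    r-other : ∀ w → w ≢ i → w ≢ j → r w ≡ P x w
    r-other w w≢i w≢j = trans (replace-≢ without-i j true w≢j) (replace-≢ (P x) i false w≢i)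

    #r : # r ≡ # (P x)
    #r = +-cancelʳ-≡ 1 _ _ (begin
      # r + 1                          ≡⟨ cong₂ (λ s t → # r + (⟦ s ⟧ + ⟦ t ⟧)) Pxi ¬Pxj ⟨
      # r + (⟦ P x i ⟧ + ⟦ P x j ⟧)    ≡⟨ sum-update₂ i j i≢j (λ w p q → cong ⟦_⟧ (r-other w p q)) ⟩
      # (P x) + (⟦ r i ⟧ + ⟦ r j ⟧)    ≡⟨ cong₂ (λ s t → # (P x) + (⟦ s ⟧ + ⟦ t ⟧)) r-i r-j ⟩
      # (P x) + 1                      ∎)
      where open ≡-Reasoning

    swap-valid : Valid swap
    swap-valid = valid-replace P x r valid r⊆N
      (subst (λ k → k ≡ a x ⊎ k ≡ a x + M) (sym #r) (proj₂ valid x))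
      where
      r⊆N : ∀ w → r w ≡ true → N x w ≡ true
      r⊆N w rw with w ≟ j | w ≟ i
      ... | yes refl | _     = Nxj
      ... | no _     | no _  = proj₁ valid x w rw

    col-i : suc (col swap i) ≡ col P i
    col-i = begin
      suc (col swap i)         ≡⟨ +-comm 1 _ ⟩
      col swap i + 1           ≡⟨ cong (λ s → col swap i + ⟦ s ⟧) Pxi ⟨
      col swap i + ⟦ P x i ⟧   ≡⟨ col-replace P x r i ⟩
      col P i + ⟦ r i ⟧        ≡⟨ cong (λ s → col P i + ⟦ s ⟧) r-i ⟩
      col P i + 0              ≡⟨ +-identityʳ _ ⟩
      col P i                  ∎
      where open ≡-Reasoning

    col-j : col swap j ≡ suc (col P j)
    col-j = begin
      col swap j               ≡⟨ +-identityʳ _ ⟨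
      col swap j + 0           ≡⟨ cong (λ s → col swap j + ⟦ s ⟧) ¬Pxj ⟨
      col swap j + ⟦ P x j ⟧   ≡⟨ col-replace P x r j ⟩
      col P j + ⟦ r j ⟧        ≡⟨ cong (λ s → col P j + ⟦ s ⟧) r-j ⟩
      col P j + 1              ≡⟨ +-comm _ 1 ⟩
      suc (col P j)            ∎
      where open ≡-Reasoning

    col-other : ∀ w → w ≢ i → w ≢ j → col swap w ≡ col P w
    col-other w w≢i w≢j = +-cancelʳ-≡ ⟦ P x w ⟧ _ _
      (trans (col-replace P x r w) (cong (λ s → col P w + ⟦ s ⟧) (r-other w w≢i w≢j)))

    -- With excess meaning `col P - b`, moving one unit from `i` to `j` changes `Φ` by twice (excess
    -- at `j`) - (excess at `i`) + 1. If the excess at `i` is larger by two or more, `Φ` falls; if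
    -- it is larger by exactly one, `Φ` is unchanged.
    swap-Φ : Φ swap + 2 * (col P i + b j) ≡ Φ P + 2 * suc (b i + col P j)
    swap-Φ = solve-for (Φ swap) (Φ P) (col swap i) (col P j) (b i) (b j)
      (potential (b i) (col swap i)) (potential (b i) (suc (col swap i)))
      (potential (b j) (col P j)) (potential (b j) (suc (col P j)))
      change
      (potential-suc (b i) (subst (_≤ n) (sym col-i) (#≤n (λ y → P y i))))
      (potential-suc (b j) (subst (_≤ n) col-j (#≤n (λ y → swap y j))))
      (sym col-i)
      where
      change : Φ swap + (potential (b i) (suc (col swap i)) + potential (b j) (col P j)) ≡
               Φ P + (potential (b i) (col swap i) + potential (b j) (suc (col P j)))
      change = subst₂
        (λ u v → Φ swap + (potential (b i) u + potential (b j) (col P j)) ≡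
                 Φ P + (potential (b i) (col swap i) + potential (b j) v))
        (sym col-i) col-j
        (sum-update₂ i j i≢j (λ w p q → cong (potential (b w)) (col-other w p q)))
      solve-for : ∀ f g di dj bi bj pi pi′ pj pj′ {d} →
        f + (pi′ + pj) ≡ g + (pi + pj′) → pi′ + 2 * bi ≡ pi + (2 * di + 1) →
        pj′ + 2 * bj ≡ pj + (2 * dj + 1) → d ≡ suc di →
        f + 2 * (d + bj) ≡ g + 2 * suc (bi + dj)
      solve-for f g di dj bi bj pi pi′ pj pj′ e₁ e₂ e₃ refl =
        +-cancelʳ-≡ (pi′ + pj + pi + pj′) _ _ (begin
          f + 2 * (suc di + bj) + (pi′ + pj + pi + pj′)
            ≡⟨ solve (f ∷ di ∷ bj ∷ pi ∷ pi′ ∷ pj ∷ pj′ ∷ []) ⟩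
          (f + (pi′ + pj)) + ((pi + (2 * di + 1)) + (pj′ + 2 * bj)) + 1
            ≡⟨ cong (_+ 1) (cong₂ _+_ e₁ (cong₂ _+_ (sym e₂) e₃)) ⟩
          (g + (pi + pj′)) + ((pi′ + 2 * bi) + (pj + (2 * dj + 1))) + 1
            ≡⟨ solve (g ∷ dj ∷ bi ∷ pi ∷ pi′ ∷ pj ∷ pj′ ∷ []) ⟩
          g + 2 * suc (bi + dj) + (pi′ + pj + pi + pj′) ∎)
        where open ≡-Reasoning

  -- Alternating paths, recorded by their columns: each step leaves `i` along an edge of `P` and
  -- arrives at `j` along an edge of `N` outside `P`, both in row `x`, which is what `Swap`
  -- exchanges. Repetitions are allowed; the length serves as induction measure.
  data Path (P : Fin n → Fin n → Bool) (s : Fin n) : ℕ → Fin n → Set where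
    []   : Path P s 0 s
    snoc : ∀ {l i j} → Path P s l i → ∀ x → P x i ≡ true → N x j ≡ true → P x j ≡ false →
           Path P s (suc l) j

  cons : ∀ {P l s i j} x → P x s ≡ true → N x i ≡ true → P x i ≡ false →
         Path P i l j → Path P s (suc l) j
  cons x Pxs Nxi ¬Pxi []                  = snoc [] x Pxs Nxi ¬Pxi
  cons x Pxs Nxi ¬Pxi (snoc p y Py Ny ¬Py) = snoc (cons x Pxs Nxi ¬Pxi p) y Py Ny ¬Py

  -- Changing row `x` leaves intact a path that does not use that row. If the path does use it, it
  -- can be cut at such a passage, where `x` is already available for a shortcut.
  avoid : ∀ {P s l i} x r → Path P s l i →
          (∃ λ k → ∃ λ j → k < l × Path P s k j × P x j ≡ true) ⊎ Path (replace P x r) s l i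
  avoid x r [] = inj₂ []
  avoid {P} x r (snoc {l} {i} {j} p y Pyi Nyj ¬Pyj) with y ≟ x
  ... | yes refl = inj₁ (l , i , ≤-refl , p , Pyi)
  ... | no y≢x with avoid x r p
  ...   | inj₁ (k , i′ , k<l , shortcut) = inj₁ (k , i′ , m≤n⇒m≤1+n k<l , shortcut)
  ...   | inj₂ p′ = inj₂ (snoc p′ y (unchanged Pyi) Nyj (unchanged ¬Pyj))
    where
    unchanged : ∀ {w v} → P y w ≡ v → replace P x r y w ≡ v
    unchanged {w} = trans (cong (λ s → s w) (replace-≢ P x r y≢x))

  -- A path can be shortened unless its intermediate excesses col - b are all
  -- one less than at s; the last swap is then neutral for Φ, and performing it
  -- moves the deficit at the end of the path one step closer to s.
  transfer : ∀ k P → Valid P → ∀ {l s t} → l < k → Path P s l t →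
             suc (suc (col P t + b s)) ≤ col P s + b t → Improvable P
  transfer (suc k) P valid {s = s} _ [] gap = ⊥-elim (1+n≰n (≤-trans (n≤1+n _) gap))
  transfer (suc k) P valid {s = s} {t} l<k (snoc {l} {i} p x Pxi Nxt ¬Pxt) gap
    -- If the excess drops by two across the last step alone, one swap lowers `Φ`.
    with suc (suc (b i + col P t)) ≤? col P i + b t
  ... | yes good = swap , swap-valid ,
        linear 1 (≤-reflexive swap-Φ ⊕ 2 ⊛ good)
          (eq (Φ swap) (Φ P) (col P i + b t) (b i + col P t))
    where
    open Swap P valid x i t Pxi Nxt ¬Pxt
    eq : ∀ f g u v → suc f + (g + 2 * suc v + 2 * u) + 1 ≡ g + (f + 2 * u + 2 * suc (suc v))
    eq = solve-∀
  -- If the drop by two is already present at `i`, the last step is discarded.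
  ... | no ¬good with suc (suc (col P i + b s)) ≤? col P s + b i
  ...   | yes gap′ = transfer k P valid (s≤s⁻¹ l<k) p gap′
  -- Otherwise the last step is swapped first. A path that uses row `x` earlier might be destroyed
  -- by this swap, so it is shortcut to `t` instead.
  ...   | no ¬gap′ with avoid x (Swap.r P valid x i t Pxi Nxt ¬Pxt) p
  ...     | inj₁ (k′ , j , k′<l , p′ , Pxj) =
            transfer k P valid (≤-trans (s≤s k′<l) (s≤s⁻¹ l<k)) (snoc p′ x Pxj Nxt ¬Pxt) gap
  ...     | inj₂ p′ with transfer k swap swap-valid (s≤s⁻¹ l<k) p′ gap″
    where
    open Swap P valid x i t Pxi Nxt ¬Pxt
    above : col P i + b t ≤ suc (b i + col P t)
    above = s≤s⁻¹ (≰⇒> ¬good)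
    s≢i : s ≢ i
    s≢i refl = 1+n≰n (linear 0 (above ⊕ gap) (eq (col P s) (b s) (col P t) (b t)))
      where
      eq : ∀ s bs t bt → suc s + (suc (bs + t) + (s + bt)) + 0 ≡ s + ((s + bt) + suc (suc (t + bs)))
      eq = solve-∀
    s≢t : s ≢ t
    s≢t refl = 1+n≰n (≤-trans (n≤1+n _) gap)
    -- By `above` and `gap` the excess at `i` is already below that at `s`; the swap lowers it once
    -- more, which restores a gap of two on the shorter path.
    gap″ : suc (suc (col swap i + b s)) ≤ col swap s + b i
    gap″ = subst₂ (λ u v → suc u + b s′ ≤ v + b i) (sym col-i) (sym (col-other s s≢i s≢t))
      (linear 0 (above ⊕ gap) (eq (col P i) (b i) (col P t) (b t) (col P s) (b s)))
      where
      s′ : Fin n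
      s′ = s
      eq : ∀ i bi t bt s bs → suc (i + bs) + (suc (bi + t) + (s + bt)) + 0
                              ≡ s + bi + ((i + bt) + suc (suc (t + bs)))
      eq = solve-∀
  ...       | P″ , valid″ , Φ″ = P″ , valid″ , ≤-trans Φ″ neutral
    where
    open Swap P valid x i t Pxi Nxt ¬Pxt
    above : col P s + b i ≤ suc (col P i + b s)
    above = s≤s⁻¹ (≰⇒> ¬gap′)
    neutral : Φ swap ≤ Φ P
    neutral = linear 0 (≤-reflexive swap-Φ ⊕ 2 ⊛ (above ⊕ gap))
      (eq (Φ swap) (Φ P) (col P i) (b i) (col P t) (b t) (col P s) (b s))
      where
      eq : ∀ f g i bi t bt s bs →
        f + (g + 2 * suc (bi + t) + 2 * (suc (i + bs) + (s + bt))) + 0 ≡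
        g + (f + 2 * (i + bt) + 2 * (s + bi + suc (suc (t + bs))))
      eq = solve-∀

-- Bringing every column within one of its target.

-- q / 8 is a fractional subgraph which meets the targets b exactly and whose
-- row sums lie between a and a + M.
module NearOptimal {n : ℕ} (N : Fin n → Fin n → Bool) (a b : Fin n → ℕ) (M : ℕ) (1≤M : 1 ≤ M)
  (q : Fin n → Fin n → ℕ) (q≤2N : ∀ x w → q x w ≤ 2 * ⟦ N x w ⟧)
  (col-q : ∀ w → sum (λ x → q x w) ≡ 8 * b w)
  (row-q≥ : ∀ x → 8 * a x ≤ sum (q x)) (row-q≤ : ∀ x → sum (q x) ≤ 8 * (a x + M))
  (a-large : ∀ x → 2 * M ≤ a x ⊎ (∀ w → N x w ≡ false)) where

  open BipartiteSubgraph N a b M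

  row-change : ∀ P x → Valid P → ∀ r → (∀ w → r w ≡ true → N x w ≡ true) →
    # r ≡ a x ⊎ # r ≡ a x + M →
    (∀ w → potential (b w) (col (replace P x r) w) ≤ potential (b w) (col P w)) →
    (∃ λ w → potential (b w) (col (replace P x r) w) < potential (b w) (col P w)) →
    Improvable P
  row-change P x valid r r⊆N #r weak (w , strict) =
    replace P x r , valid-replace P x r valid r⊆N #r , sum-mono-< weak w strict

  -- Every deleted edge ends in a column above its target, which thereby moves one step closer, and
  -- deleting exactly `M` edges takes the row to its lower allowed value.
  drop : ∀ P x → Valid P → (R : Fin n → Bool) → (∀ w → R w ≡ true → b w < col P w) →
    row P x ≡ a x + M → M ≤ # (λ w → P x w ∧ R w) → Improvable P
  drop P x valid R over row≡ enough with choose _ M enough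
  ... | g , g⊆PR , #g = row-change P x valid r r⊆N (inj₁ #r) (λ w → ≤-of w (g w) refl)
        (w₀ , <-of w₀ gw₀)
    where
    r : Fin n → Bool
    r w = P x w ∧ not (g w)
    r⊆N : ∀ w → r w ≡ true → N x w ≡ true
    r⊆N w rw = proj₁ valid x w (proj₁ (∧-true rw))
    w₀∈g : ∃ λ w → g w ≡ true
    w₀∈g = #>0⇒∃ g (subst (1 ≤_) (sym #g) 1≤M)
    w₀ : Fin n
    w₀ = proj₁ w₀∈g
    gw₀ : g w₀ ≡ true
    gw₀ = proj₂ w₀∈g
    pointwise : ∀ w → ⟦ r w ⟧ + ⟦ g w ⟧ ≡ ⟦ P x w ⟧
    pointwise w with P x w in p | g w in eq
    ... | true  | true  = refl
    ... | true  | false = refl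
    ... | false | false = refl
    ... | false | true  = ⊥-elim (false≢true p (proj₁ (∧-true (g⊆PR w eq))))
    #r : # r ≡ a x
    #r = +-cancelʳ-≡ M _ _ (begin
      # r + M       ≡⟨ cong (# r +_) #g ⟨
      # r + # g     ≡⟨ sum-+ (λ w → ⟦ r w ⟧) (λ w → ⟦ g w ⟧) ⟨
      sum (λ w → ⟦ r w ⟧ + ⟦ g w ⟧)  ≡⟨ sum-cong-≗ pointwise ⟩
      # (P x)       ≡⟨ row≡ ⟩
      a x + M       ∎)
      where open ≡-Reasoning
    new-col : ∀ w → col (replace P x r) w + ⟦ g w ⟧ ≡ col P w
    new-col w = +-cancelʳ-≡ ⟦ r w ⟧ _ _ (begin
      c′ + ⟦ g w ⟧ + ⟦ r w ⟧     ≡⟨ +-assoc c′ _ _ ⟩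
      c′ + (⟦ g w ⟧ + ⟦ r w ⟧)   ≡⟨ cong (c′ +_) (trans (+-comm ⟦ g w ⟧ _) (pointwise w)) ⟩
      c′ + ⟦ P x w ⟧             ≡⟨ col-replace P x r w ⟩
      col P w + ⟦ r w ⟧          ∎)
      where
      open ≡-Reasoning
      c′ : ℕ
      c′ = col (replace P x r) w
    <-of : ∀ w → g w ≡ true → potential (b w) (col (replace P x r) w) < potential (b w) (col P w)
    <-of w gw = subst (λ d → potential (b w) (col (replace P x r) w) < potential (b w) d) suc-col
      (potential-pred-< (subst (_≤ n) (sym suc-col) (#≤n (λ y → P y w)))
        (s≤s⁻¹ (subst (b w <_) (sym suc-col) (over w (proj₂ (∧-true (g⊆PR w gw)))))))
      where
      suc-col : suc (col (replace P x r) w) ≡ col P w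
      suc-col = trans (+-comm 1 _)
        (trans (cong (λ s → col (replace P x r) w + ⟦ s ⟧) (sym gw)) (new-col w))
    ≤-of : ∀ w s → g w ≡ s →
           potential (b w) (col (replace P x r) w) ≤ potential (b w) (col P w)
    ≤-of w true  gw = <⇒≤ (<-of w gw)
    ≤-of w false gw = ≤-reflexive (cong (potential (b w))
      (trans (sym (+-identityʳ _))
        (trans (cong (λ s → col (replace P x r) w + ⟦ s ⟧) (sym gw)) (new-col w))))

  add : ∀ P x → Valid P → (R : Fin n → Bool) → (∀ w → R w ≡ true → col P w < b w) →
    row P x ≡ a x → M ≤ # (λ w → (N x w ∧ not (P x w)) ∧ R w) → Improvable P
  add P x valid R under row≡ enough with choose _ M enough
  ... | g , g⊆ , #g = row-change P x valid r r⊆N (inj₂ #r) (λ w → ≤-of w (g w) refl)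
        (w₀ , <-of w₀ gw₀)
    where
    r : Fin n → Bool
    r w = P x w ∨ g w
    g⊆N : ∀ w → g w ≡ true → N x w ≡ true
    g⊆N w gw = proj₁ (∧-true (proj₁ (∧-true (g⊆ w gw))))
    r⊆N : ∀ w → r w ≡ true → N x w ≡ true
    r⊆N w rw with P x w in eq
    ... | true  = proj₁ valid x w eq
    ... | false = g⊆N w rw
    w₀∈g : ∃ λ w → g w ≡ true
    w₀∈g = #>0⇒∃ g (subst (1 ≤_) (sym #g) 1≤M)
    w₀ : Fin n
    w₀ = proj₁ w₀∈g
    gw₀ : g w₀ ≡ true
    gw₀ = proj₂ w₀∈g
    pointwise : ∀ w → ⟦ P x w ⟧ + ⟦ g w ⟧ ≡ ⟦ r w ⟧
    pointwise w with P x w in p | g w in eq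
    ... | true  | false = refl
    ... | false | false = refl
    ... | false | true  = refl
    ... | true  | true  = ⊥-elim (false≢true (cong not p)
          (proj₂ (∧-true {N x w} (proj₁ (∧-true {N x w ∧ not (P x w)} (g⊆ w eq))))))
    #r : # r ≡ a x + M
    #r = begin
      # r                               ≡⟨ sum-cong-≗ pointwise ⟨
      sum (λ w → ⟦ P x w ⟧ + ⟦ g w ⟧)   ≡⟨ sum-+ (λ w → ⟦ P x w ⟧) (λ w → ⟦ g w ⟧) ⟩
      # (P x) + # g                     ≡⟨ cong₂ _+_ row≡ #g ⟩
      a x + M                           ∎
      where open ≡-Reasoning
    new-col : ∀ w → col (replace P x r) w ≡ col P w + ⟦ g w ⟧
    new-col w = +-cancelʳ-≡ ⟦ P x w ⟧ _ _ (begin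
      col (replace P x r) w + ⟦ P x w ⟧   ≡⟨ col-replace P x r w ⟩
      col P w + ⟦ r w ⟧
        ≡⟨ cong (col P w +_) (trans (sym (pointwise w)) (+-comm ⟦ P x w ⟧ _)) ⟩
      col P w + (⟦ g w ⟧ + ⟦ P x w ⟧)     ≡⟨ +-assoc (col P w) _ _ ⟨
      col P w + ⟦ g w ⟧ + ⟦ P x w ⟧       ∎)
      where open ≡-Reasoning
    <-of : ∀ w → g w ≡ true → potential (b w) (col (replace P x r) w) < potential (b w) (col P w)
    <-of w gw = subst (λ d → potential (b w) d < potential (b w) (col P w)) (sym suc-col)
      (potential-suc-< (subst (_≤ n) suc-col (#≤n (λ y → replace P x r y w)))
        (under w (proj₂ (∧-true (g⊆ w gw)))))
      where
      suc-col : col (replace P x r) w ≡ suc (col P w)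
      suc-col = trans (new-col w) (trans (cong (λ s → col P w + ⟦ s ⟧) gw) (+-comm _ 1))
    ≤-of : ∀ w s → g w ≡ s →
           potential (b w) (col (replace P x r) w) ≤ potential (b w) (col P w)
    ≤-of w true  gw = <⇒≤ (<-of w gw)
    ≤-of w false gw = ≤-reflexive (cong (potential (b w))
      (trans (new-col w) (trans (cong (λ s → col P w + ⟦ s ⟧) gw) (+-identityʳ _))))

  weigh : (R : Fin n → Bool) (f : Fin n → Fin n → ℕ) →
          sum (λ x → sum (λ w → ⟦ R w ⟧ * f x w)) ≡ sum (λ w → ⟦ R w ⟧ * sum (λ x → f x w))
  weigh R f = trans (∑-comm (λ x w → ⟦ R w ⟧ * f x w))
                    (sum-cong-≗ (λ w → sum-scale ⟦ R w ⟧ (λ x → f x w)))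

  sum-q : ∀ R → sum (λ x → sum (λ w → ⟦ R w ⟧ * q x w)) ≡ sum (λ w → ⟦ R w ⟧ * (8 * b w))
  sum-q R = trans (weigh R q) (sum-cong-≗ (λ w → cong (⟦ R w ⟧ *_) (col-q w)))

  sum-P : ∀ R P → sum (λ x → sum (λ w → ⟦ R w ⟧ * (8 * ⟦ P x w ⟧))) ≡
                  sum (λ w → ⟦ R w ⟧ * (8 * col P w))
  sum-P R P = trans (weigh R (λ x w → 8 * ⟦ P x w ⟧))
                    (sum-cong-≗ (λ w → cong (⟦ R w ⟧ *_) (sum-scale 8 (λ x → ⟦ P x w ⟧))))

  weighted-< : (R : Fin n → Bool) (f g : Fin n → ℕ) → (∀ w → R w ≡ true → f w < g w) →
    ∀ {w₀} → R w₀ ≡ true → sum (λ w → ⟦ R w ⟧ * (8 * f w)) < sum (λ w → ⟦ R w ⟧ * (8 * g w))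
  weighted-< R f g f<g {w₀} Rw₀ = sum-mono-< weak w₀ strict
    where
    weak : ∀ w → ⟦ R w ⟧ * (8 * f w) ≤ ⟦ R w ⟧ * (8 * g w)
    weak w with R w in eq
    ... | false = z≤n
    ... | true  = +-monoˡ-≤ 0 (8 ⊛ <⇒≤ (f<g w eq))
    strict : ⟦ R w₀ ⟧ * (8 * f w₀) < ⟦ R w₀ ⟧ * (8 * g w₀)
    strict rewrite Rw₀ = +-monoˡ-< 0 (*-monoʳ-< 8 (f<g w₀ Rw₀))

  Step : (Fin n → Fin n → Bool) → Fin n → Fin n → Set
  Step P w w′ = ∃ λ x → P x w ≡ true × N x w′ ≡ true × P x w′ ≡ false

  step? : ∀ P w w′ → Dec (Step P w w′)
  step? P w w′ = any? λ x → (P x w ≟ᵇ true) ×-dec (N x w′ ≟ᵇ true) ×-dec (P x w′ ≟ᵇ false)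

  -- On `R` the columns of `P` exceed the targets, which `q / 8` meets, so some row `x` carries more
  -- of `P` than of `q / 8` inside `R`. Since `R` is closed, all edges of `N` from `x` that leave
  -- `R` lie in `P`. Such a row must be at its upper value and have `M` edges into `R` to drop.
  closed-over : ∀ P → Valid P → (R : Fin n → Bool) → (∀ w w′ → R w ≡ true → Step P w w′ → R w′ ≡ true) →
    (∀ w → R w ≡ true → b w < col P w) → ∀ {w₀} → R w₀ ≡ true → Improvable P
  closed-over P valid R closed over Rw₀
    with sum-<⇒∃ (λ x → sum (λ w → ⟦ R w ⟧ * q x w)) (λ x → sum (λ w → ⟦ R w ⟧ * (8 * ⟦ P x w ⟧)))
           (subst₂ _<_ (sym (sum-q R)) (sym (sum-P R P)) (weighted-< R b (col P) over Rw₀))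
  ... | x , F<G with sum-<⇒∃ (λ w → ⟦ R w ⟧ * q x w) (λ w → ⟦ R w ⟧ * (8 * ⟦ P x w ⟧)) F<G
  ...   | w₁ , lt = conclude
    where
    F G : ℕ
    F = sum (λ w → ⟦ R w ⟧ * q x w)
    G = sum (λ w → ⟦ R w ⟧ * (8 * ⟦ P x w ⟧))
    in-R : R w₁ ≡ true × P x w₁ ≡ true
    in-R = split (R w₁) (P x w₁) lt
      where
      split : ∀ s t {k} → ⟦ s ⟧ * k < ⟦ s ⟧ * (8 * ⟦ t ⟧) → s ≡ true × t ≡ true
      split true  true  _ = refl , refl
      split true  false p = ⊥-elim (n≮0 p)
      split false t     p = ⊥-elim (n≮0 p)
    outside : ∀ w → R w ≡ false → N x w ≡ true → P x w ≡ true
    outside w ¬Rw Nxw with P x w in eq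
    ... | true  = refl
    ... | false = ⊥-elim (false≢true ¬Rw (closed w₁ w (proj₁ in-R) (x , proj₂ in-R , Nxw , eq)))
    pO pR : ℕ
    pO = # (λ w → P x w ∧ not (R w))
    pR = # (λ w → P x w ∧ R w)
    balance : pR + pO ≡ row P x
    balance = trans (sym (sum-+ (λ w → ⟦ P x w ∧ R w ⟧) (λ w → ⟦ P x w ∧ not (R w) ⟧)))
      (sum-cong-≗ (λ w → split (P x w) (R w)))
      where
      split : ∀ s t → ⟦ s ∧ t ⟧ + ⟦ s ∧ not t ⟧ ≡ ⟦ s ⟧
      split true  true  = refl
      split true  false = refl
      split false _     = refl
    -- Outside `R` an edge of `P` weighs 8 against at most 2 in `q`, hence a surplus of 6 for each
    -- of the `pO` edges.
    total : sum (q x) + (G + 6 * pO) ≤ F + 8 * row P x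
    total = subst₂ _≤_
      (trans (sum-+ (q x) _) (cong (sum (q x) +_) (trans (sum-+ (λ w → ⟦ R w ⟧ * (8 * ⟦ P x w ⟧)) _)
        (cong (G +_) (sum-scale 6 (λ w → ⟦ P x w ∧ not (R w) ⟧))))))
      (trans (sum-+ (λ w → ⟦ R w ⟧ * q x w) _) (cong (F +_) (sum-scale 8 (λ w → ⟦ P x w ⟧))))
      (sum-mono-≤ pointwise)
      where
      pointwise : ∀ w → q x w + (⟦ R w ⟧ * (8 * ⟦ P x w ⟧) + 6 * ⟦ P x w ∧ not (R w) ⟧) ≤
                        ⟦ R w ⟧ * q x w + 8 * ⟦ P x w ⟧
      pointwise w with R w in Rw | P x w in Pxw
      ... | true  | true  = ≤-reflexive (cong (_+ 8) (sym (+-identityʳ (q x w))))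
      ... | true  | false = ≤-reflexive (cong (_+ 0) (sym (+-identityʳ (q x w))))
      ... | false | true  = +-monoˡ-≤ 6 (≤-trans (q≤2N x w) (2 ⊛ ⟦⟧≤1 (N x w)))
      ... | false | false with N x w in Nxw
      ...   | true  = ⊥-elim (false≢true Pxw (outside w Rw Nxw))
      ...   | false = ≤-trans (≤-reflexive (+-identityʳ _))
                        (subst (λ s → q x w ≤ 2 * ⟦ s ⟧) Nxw (q≤2N x w))
    key : suc (sum (q x) + 6 * pO) ≤ 8 * row P x
    key = linear 0 (total ⊕ F<G) (eq (sum (q x)) pO (row P x) F G)
      where
      eq : ∀ s o p f g → suc (s + 6 * o) + (f + 8 * p + g) + 0 ≡ 8 * p + (s + (g + 6 * o) + suc f)
      eq = solve-∀
    conclude : Improvable P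
    conclude with a-large x
    ... | inj₂ empty = ⊥-elim (false≢true (empty w₁) (proj₁ valid x w₁ (proj₂ in-R)))
    ... | inj₁ 2M≤a with proj₂ valid x
    ...   | inj₁ low = ⊥-elim (1+n≰n (≤-trans (s≤s (m≤m+n _ (6 * pO)))
              (≤-trans key (≤-trans (≤-reflexive (cong (8 *_) low)) (row-q≥ x)))))
    -- From `key` and `8 * a x ≤ sum (q x)` it follows that `6 * pO < 8 * M`. As `2 * M ≤ a x`, more
    -- than `M` of the `a x + M` edges of the row end in `R`.
    ...   | inj₂ high = drop P x valid R over high (*-cancelˡ-≤ 6
              (linear (4 * M + 1) (subst (λ p → suc (sum (q x) + 6 * pO) ≤ 8 * p) high key ⊕ row-q≥ x
                ⊕ 6 ⊛ ≤-reflexive (trans (sym high) (sym balance)) ⊕ 6 ⊛ 2M≤a)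
                (eq (a x) M (sum (q x)) pO pR)))
      where
      eq : ∀ a M s o r → 6 * M + (8 * (a + M) + (s + (6 * (r + o) + 6 * a))) + (4 * M + 1) ≡
                         6 * r + (suc (s + 6 * o) + (8 * a + (6 * (a + M) + 6 * (2 * M))))
      eq = solve-∀

  -- Here `R` is closed under predecessors, so a row with less of `P` than of `q / 8` inside `R` has
  -- all its `P`-edges in `R`. Comparison with `sum (q x)` excludes the upper value, and since `q`
  -- is at most 2 on an edge, more than `3 * a x` edges of `N` into `R` are free to be added.
  closed-under : ∀ P → Valid P → (R : Fin n → Bool) → (∀ w w′ → R w ≡ true → Step P w′ w → R w′ ≡ true) →
    (∀ w → R w ≡ true → col P w < b w) → ∀ {w₀} → R w₀ ≡ true → Improvable P
  closed-under P valid R closed under Rw₀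
    with sum-<⇒∃ (λ x → sum (λ w → ⟦ R w ⟧ * (8 * ⟦ P x w ⟧))) (λ x → sum (λ w → ⟦ R w ⟧ * q x w))
           (subst₂ _<_ (sym (sum-P R P)) (sym (sum-q R)) (weighted-< R (col P) b under Rw₀))
  ... | x , G<F with sum-<⇒∃ (λ w → ⟦ R w ⟧ * (8 * ⟦ P x w ⟧)) (λ w → ⟦ R w ⟧ * q x w) G<F
  ...   | w₁ , lt = conclude
    where
    F G : ℕ
    F = sum (λ w → ⟦ R w ⟧ * q x w)
    G = sum (λ w → ⟦ R w ⟧ * (8 * ⟦ P x w ⟧))
    in-R : R w₁ ≡ true × N x w₁ ≡ true × P x w₁ ≡ false
    in-R = split (R w₁) (N x w₁) (P x w₁) (q≤2N x w₁) lt
      where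
      split : ∀ s t u {k} → k ≤ 2 * ⟦ t ⟧ → ⟦ s ⟧ * (8 * ⟦ u ⟧) < ⟦ s ⟧ * k →
              s ≡ true × t ≡ true × u ≡ false
      split true  true  false _   _ = refl , refl , refl
      split true  false u     z≤n p = ⊥-elim (n≮0 p)
      split true  true  true  k≤2 p =
        ⊥-elim (<⇒≱ p (+-monoˡ-≤ 0 (≤-trans k≤2 (s≤s (s≤s z≤n)))))
      split false _     _     _   p = ⊥-elim (n≮0 p)
    inside : ∀ w → P x w ≡ true → R w ≡ true
    inside w Pxw = closed w₁ w (proj₁ in-R) (x , Pxw , proj₂ in-R)
    free : ℕ
    free = # (λ w → (N x w ∧ not (P x w)) ∧ R w)
    8row≤G : 8 * row P x ≤ G
    8row≤G = subst (_≤ G) (sum-scale 8 (λ w → ⟦ P x w ⟧)) (sum-mono-≤ pointwise)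
      where
      pointwise : ∀ w → 8 * ⟦ P x w ⟧ ≤ ⟦ R w ⟧ * (8 * ⟦ P x w ⟧)
      pointwise w with P x w in Pxw
      ... | false = z≤n
      ... | true  rewrite inside w Pxw = ≤-refl
    F≤q : F ≤ sum (q x)
    F≤q = sum-mono-≤ (λ w → pointwise (R w) (q x w))
      where
      pointwise : ∀ s k → ⟦ s ⟧ * k ≤ k
      pointwise true  k = ≤-reflexive (+-identityʳ k)
      pointwise false k = z≤n
    F≤free : F ≤ 2 * free + 2 * row P x
    F≤free = subst (F ≤_)
      (trans (sum-+ (λ w → 2 * ⟦ (N x w ∧ not (P x w)) ∧ R w ⟧) (λ w → 2 * ⟦ P x w ⟧))
        (cong₂ _+_ (sum-scale 2 (λ w → ⟦ (N x w ∧ not (P x w)) ∧ R w ⟧)) (sum-scale 2 (λ w → ⟦ P x w ⟧))))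
      (sum-mono-≤ (λ w → pointwise (R w) (N x w) (P x w) (q≤2N x w)))
      where
      pointwise : ∀ s t u {k} → k ≤ 2 * ⟦ t ⟧ → ⟦ s ⟧ * k ≤ 2 * ⟦ (t ∧ not u) ∧ s ⟧ + 2 * ⟦ u ⟧
      pointwise false t     u     _   = z≤n
      pointwise true  false u     z≤n = z≤n
      pointwise true  true  false k≤2 = +-monoˡ-≤ 0 k≤2
      pointwise true  true  true  k≤2 = ≤-trans (+-monoˡ-≤ 0 k≤2) ≤-refl
    conclude : Improvable P
    conclude with a-large x
    ... | inj₂ empty = ⊥-elim (false≢true (empty w₁) (proj₁ (proj₂ in-R)))
    ... | inj₁ 2M≤a with proj₂ valid x
    ...   | inj₂ high = ⊥-elim (1+n≰n (≤-trans (s≤s 8row≤G) (≤-trans G<F (≤-trans F≤q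
              (≤-trans (row-q≤ x) (≤-reflexive (cong (8 *_) (sym high))))))))
    ...   | inj₁ low = add P x valid R under low (*-cancelˡ-≤ 2
              (linear (10 * M + 1) (8row≤G ⊕ G<F ⊕ F≤free ⊕ 6 ⊛ ≤-reflexive (sym low) ⊕ 6 ⊛ 2M≤a)
                (eq (a x) M F G free (row P x))))
      where
      eq : ∀ a M f g c p → 2 * M + (g + (f + (2 * c + 2 * p + (6 * p + 6 * a)))) + (10 * M + 1) ≡
                           2 * c + (8 * p + (suc g + (f + (6 * a + 6 * (2 * M)))))
      eq = solve-∀

  -- The predicate given to `saturate` says that the excess is at most one below that at `w₀`. A
  -- failure yields a path for `transfer`; otherwise every column of the closed set has positive
  -- excess.
  fix-over : ∀ P → Valid P → ∀ w₀ → suc (suc (b w₀)) ≤ col P w₀ → Improvable P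
  fix-over P valid w₀ over
    with saturate (step? P) {λ w → ∃ λ l → Path P w₀ l w}
           (λ { (l , p) (x , Pw , Nw′ , ¬Pw′) → suc l , snoc p x Pw Nw′ ¬Pw′ })
           (λ w → col P w₀ + b w ≤? suc (col P w + b w₀)) w₀ (0 , []) (n≤1+n _)
  ... | inj₁ (w , (l , p) , ¬Q) = transfer (suc l) P valid ≤-refl p (≰⇒> ¬Q)
  ... | inj₂ (R , Rw₀ , RQ , closed) = closed-over P valid R closed
          (λ w Rw → linear 0 (over ⊕ RQ w Rw) (eq (col P w) (b w) (col P w₀) (b w₀))) Rw₀
    where
    eq : ∀ d b d₀ b₀ → suc b + (d₀ + suc (d + b₀)) + 0 ≡ d + (suc (suc b₀) + (d₀ + b))
    eq = solve-∀

  -- The search runs backwards, over columns from which a path leads to `w₀`, because `transfer`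
  -- moves degree from the start of a path to its end.
  fix-under : ∀ P → Valid P → ∀ w₀ → suc (suc (col P w₀)) ≤ b w₀ → Improvable P
  fix-under P valid w₀ under
    with saturate {T = λ w w′ → Step P w′ w} (λ w w′ → step? P w′ w) {λ w → ∃ λ l → Path P w l w₀}
           (λ { (l , p) (x , Pw′ , Nw , ¬Pw) → suc l , cons x Pw′ Nw ¬Pw p })
           (λ w → col P w + b w₀ ≤? suc (col P w₀ + b w)) w₀ (0 , []) (n≤1+n _)
  ... | inj₁ (w , (l , p) , ¬Q) = transfer (suc l) P valid ≤-refl p (≰⇒> ¬Q)
  ... | inj₂ (R , Rw₀ , RQ , closed) = closed-under P valid R closed
          (λ w Rw → linear 0 (under ⊕ RQ w Rw) (eq (col P w) (b w) (col P w₀) (b w₀))) Rw₀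
    where
    eq : ∀ d b d₀ b₀ → suc d + (b₀ + suc (d₀ + b)) + 0 ≡ b + (suc (suc d₀) + (d + b₀))
    eq = solve-∀

  Near : (Fin n → Fin n → Bool) → Set
  Near P = ∀ w → col P w ≤ suc (b w) × b w ≤ suc (col P w)

  abstract
    near-subgraph : ∃ λ P → Valid P × Near P
    near-subgraph = descend (λ { (P , _) → Φ P }) step (start , start-valid)
      where
      -- Weights of at most 2 give `8 * a x ≤ 2 * # (N x)`, so `N` has enough edges for a first
      -- subgraph with row sums `a`.
      sum-q≤ : ∀ x → sum (q x) ≤ 2 * # (N x)
      sum-q≤ x = ≤-trans (sum-mono-≤ (q≤2N x)) (≤-reflexive (sum-scale 2 (λ w → ⟦ N x w ⟧)))
      chosen : ∀ x → ∃ λ g → (∀ w → g w ≡ true → N x w ≡ true) × # g ≡ a x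
      chosen x = choose (N x) (a x) (*-cancelˡ-≤ 8
        (≤-trans (row-q≥ x) (≤-trans (sum-q≤ x) (*-monoˡ-≤ (# (N x)) {2} {8} (s≤s (s≤s z≤n))))))
      start : Fin n → Fin n → Bool
      start x = proj₁ (chosen x)
      start-valid : Valid start
      start-valid = (λ x → proj₁ (proj₂ (chosen x))) , (λ x → inj₁ (proj₂ (proj₂ (chosen x))))
      step : ∀ (σ : ∃ Valid) → (∃ λ P → Valid P × Near P) ⊎ (∃ λ (σ′ : ∃ Valid) → Φ (proj₁ σ′) < Φ (proj₁ σ))
      step (P , valid) with any? (λ w → suc (suc (b w)) ≤? col P w)
      ... | yes (w , over) with fix-over P valid w over
      ...   | P′ , valid′ , lt = inj₂ ((P′ , valid′) , lt)
      step (P , valid) | no ¬over with any? (λ w → suc (suc (col P w)) ≤? b w)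
      ... | yes (w , under) with fix-under P valid w under
      ...   | P′ , valid′ , lt = inj₂ ((P′ , valid′) , lt)
      step (P , valid) | no ¬over | no ¬under = inj₁ (P , valid , λ w →
        s≤s⁻¹ (≰⇒> (λ p → ¬over (w , p))) , s≤s⁻¹ (≰⇒> (λ p → ¬under (w , p))))

-- Cuts and residue targets.

Symmetricᵇ Looplessᵇ : (Fin n → Fin n → Bool) → Set
Symmetricᵇ E = ∀ u v → E u v ≡ E v u
Looplessᵇ E = ∀ v → E v v ≡ false

_⊆ᵇ_ : (P E : Fin n → Fin n → Bool) → Set
P ⊆ᵇ E = ∀ u v → P u v ≡ true → E u v ≡ true

abstract
  -- A locally maximal cut suffices: moving `v` across exchanges its neighbours on the two sides, so
  -- at least half of them lie opposite.
  max-cut : (Γ : Fin n → Fin n → Bool) → Symmetricᵇ Γ → Looplessᵇ Γ →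
    ∃ λ (side : Fin n → Bool) → ∀ v → # (Γ v) ≤ 2 * # (λ u → Γ v u ∧ (side v xor side u))
  max-cut {n} Γ Γ-sym loopless with locally-optimal search Γ Γ-sym loopless agree agree-sym true
    where
    search : {P : Bool → Set} → (∀ s → Dec (P s)) → Dec (∃ P)
    search P? with P? true | P? false
    ... | yes p | _      = yes (true , p)
    ... | no _  | yes p  = yes (false , p)
    ... | no ¬t | no ¬f  = no λ { (true , p) → ¬t p ; (false , p) → ¬f p }
    agree : Bool → Bool → ℕ
    agree s t = ⟦ not (s xor t) ⟧
    agree-sym : ∀ s t → agree s t ≡ agree t s
    agree-sym true  true  = refl
    agree-sym true  false = refl
    agree-sym false true  = refl
    agree-sym false false = refl
  ... | side , optimal = side , half
    where
    half : ∀ v → # (Γ v) ≤ 2 * # (λ u → Γ v u ∧ (side v xor side u))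
    half v = begin
      # (Γ v)                       ≡⟨ sum-cong-≗ (λ u → split (Γ v u) (side v) (side u)) ⟩
      sum (λ u → same u + cross u)  ≡⟨ sum-+ same cross ⟩
      sum same + sum cross          ≤⟨ +-monoˡ-≤ (sum cross) (optimal v (not (side v))) ⟩
      sum (λ u → ⟦ Γ v u ⟧ * ⟦ not (not (side v) xor side u) ⟧) + sum cross
        ≡⟨ cong (_+ sum cross) (sum-cong-≗ (λ u → flip (Γ v u) (side v) (side u))) ⟩
      sum cross + sum cross         ≡⟨ cong (sum cross +_) (+-identityʳ (sum cross)) ⟨
      2 * sum cross                 ∎
      where
      open ≤-Reasoning
      same cross : Fin n → ℕ
      same u = ⟦ Γ v u ⟧ * ⟦ not (side v xor side u) ⟧
      cross u = ⟦ Γ v u ∧ (side v xor side u) ⟧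
      split : ∀ g s t → ⟦ g ⟧ ≡ ⟦ g ⟧ * ⟦ not (s xor t) ⟧ + ⟦ g ∧ (s xor t) ⟧
      split false _     _     = refl
      split true  true  true  = refl
      split true  true  false = refl
      split true  false true  = refl
      split true  false false = refl
      flip : ∀ g s t → ⟦ g ⟧ * ⟦ not (not s xor t) ⟧ ≡ ⟦ g ∧ (s xor t) ⟧
      flip false _     _     = refl
      flip true  true  true  = refl
      flip true  true  false = refl
      flip true  false true  = refl
      flip true  false false = refl

-- The least member of the residue class that is at least `D / 8`. As `D` grows it is kept while it
-- suffices and then advanced by `M`.
round-up : ∀ {M r} → r < M → ∀ D → ∃ λ z → D ≤ 8 * (r + M * z) × 8 * (r + M * z) < D + 8 * M
round-up {M} {r} r<M zero = 0 , z≤n , *-monoʳ-< 8 (subst (_< M) (sym eq) r<M)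
  where
  eq : r + M * 0 ≡ r
  eq = trans (cong (r +_) (*-zeroʳ M)) (+-identityʳ r)
round-up {M} {r} r<M (suc D) with round-up r<M D
... | z , lo , hi with D <? 8 * (r + M * z)
...   | yes lt = z , lt , m≤n⇒m≤1+n hi
...   | no ≮ = suc z ,
        linear 7 (lo ⊕ 8 ⊛ ≤-trans (s≤s z≤n) r<M) (eq₁ D r (M * z) M (M * suc z) (*-suc M z)) ,
        linear 0 (≮⇒≥ ≮) (eq₂ D r (M * z) M (M * suc z) (*-suc M z))
  where
  eq₁ : ∀ D r k M k′ → k′ ≡ M + k → suc D + (8 * (r + k) + 8 * M) + 7 ≡ 8 * (r + k′) + (D + 8 * 1)
  eq₁ D r k M _ refl = solve (D ∷ r ∷ k ∷ M ∷ [])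
  eq₂ : ∀ D r k M k′ → k′ ≡ M + k → suc (8 * (r + k′)) + D + 0 ≡ suc D + 8 * M + 8 * (r + k)
  eq₂ D r k M _ refl = solve (D ∷ r ∷ k ∷ M ∷ [])

-- The error is e - 1; the shift by 1 avoids subtraction.
HasResidue : ℕ → ℕ → ℕ → Set
HasResidue M r p = ∃ λ z → ∃ λ e → e ≤ 2 × suc p ≡ r + M * z + e

residue-of-row : ∀ {M r z a p} → a ≡ r + M * z → p ≡ a ⊎ p ≡ a + M → HasResidue M r p
residue-of-row {M} {r} {z} refl (inj₁ refl) = z , 1 , s≤s z≤n , +-comm 1 _
residue-of-row {M} {r} {z} refl (inj₂ refl) = suc z , 1 , s≤s z≤n , eq r M z
  where
  eq : ∀ r M z → suc (r + M * z + M) ≡ r + M * suc z + 1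
  eq = solve-∀

residue-of-col : ∀ {M r z b p} → b ≡ r + M * z → p ≤ suc b × b ≤ suc p → HasResidue M r p
residue-of-col {M} {r} {z} {b} {p} refl (p≤ , b≤) = z , suc p ∸ b ,
  ≤-trans (∸-monoˡ-≤ b (s≤s p≤)) (≤-reflexive (m+n∸n≡m 2 b)) , sym (m+[n∸m]≡n b≤)

-- A class uses at most about a quarter of the degree, so that enough edges remain for the later
-- classes.
small-of-row : ∀ {M a p s c g} → p ≡ a ⊎ p ≡ a + M → 8 * a ≤ s → s ≤ 2 * c → c ≤ g → 4 * p ≤ g + 4 * M
small-of-row {M} {a} {p} {s} {c} {g} p≡ 8a≤s s≤2c c≤g =
  *-cancelˡ-≤ 2 (linear 0 (8 ⊛ p≤ p≡ ⊕ 8a≤s ⊕ s≤2c ⊕ 2 ⊛ c≤g) (eq p g M a s c))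
  where
  p≤ : p ≡ a ⊎ p ≡ a + M → p ≤ a + M
  p≤ (inj₁ refl) = m≤m+n _ _
  p≤ (inj₂ refl) = ≤-refl
  eq : ∀ p g M a s c → 2 * (4 * p) + (8 * (a + M) + (s + (2 * c + 2 * g))) + 0 ≡
                       2 * (g + 4 * M) + (8 * p + (8 * a + (s + 2 * c)))
  eq = solve-∀

small-of-col : ∀ {M b p g} → p ≤ suc b → 8 * b ≤ g + 8 * M → 48 ≤ g → 4 * p ≤ g + 4 * M
small-of-col {M} {b} {p} {g} p≤ 8b≤ 48≤g =
  *-cancelˡ-≤ 2 (linear 40 (8 ⊛ p≤ ⊕ 8b≤ ⊕ 48≤g) (eq p g M b))
  where
  eq : ∀ p g M b → 2 * (4 * p) + (8 * suc b + (g + 8 * M + g)) + 40 ≡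
                   2 * (g + 4 * M) + (8 * p + (8 * b + 48))
  eq = solve-∀

module Undirect {n : ℕ} (Γ : Fin n → Fin n → Bool) (Γ-sym : Symmetricᵇ Γ) (side : Fin n → Bool)
  (D : Fin n → Fin n → Bool) (D⊆ : ∀ u v → D u v ≡ true → Γ u v ∧ (side u ∧ not (side v)) ≡ true) where

  P : Fin n → Fin n → Bool
  P u v = D u v ∨ D v u

  P-sym : Symmetricᵇ P
  P-sym u v = ∨-comm (D u v) (D v u)

  P⊆Γ : P ⊆ᵇ Γ
  P⊆Γ u v Puv with D u v in eq
  ... | true  = proj₁ (∧-true (D⊆ u v eq))
  ... | false = trans (Γ-sym u v) (proj₁ (∧-true (D⊆ v u Puv)))

  D-side : ∀ u v → D u v ≡ true → side u ≡ true × side v ≡ false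
  D-side u v Duv with Γ u v | side u | side v | D⊆ u v Duv
  ... | true | true | false | _ = refl , refl

  -- Arcs of `D` cross the cut in one direction only, so a vertex has outgoing or incoming arcs but
  -- never both.
  deg-row : ∀ v → side v ≡ true → # (P v) ≡ # (D v)
  deg-row v sv = sum-cong-≗ (λ u → cong ⟦_⟧ (eq u))
    where
    eq : ∀ u → D v u ∨ D u v ≡ D v u
    eq u with D u v in Duv
    ... | true  = ⊥-elim (false≢true (proj₂ (D-side u v Duv)) sv)
    ... | false = ∨-identityʳ (D v u)

  deg-col : ∀ v → side v ≡ false → # (P v) ≡ # (λ u → D u v)
  deg-col v sv = sum-cong-≗ (λ u → cong ⟦_⟧ (eq u))
    where
    eq : ∀ u → D v u ∨ D u v ≡ D u v
    eq u with D v u in Dvu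
    ... | true  = ⊥-elim (false≢true sv (proj₁ (D-side v u Dvu)))
    ... | false = refl

-- One edge class with degrees in prescribed residue classes.

module EdgeClass {n : ℕ} (Γ : Fin n → Fin n → Bool) (Γ-sym : Symmetricᵇ Γ) (loopless : Looplessᵇ Γ)
  (M : ℕ) (1≤M : 1 ≤ M) (dense : ∀ v → 48 * M ≤ # (Γ v)) (r : Fin n → ℕ) (r<M : ∀ v → r v < M) where

  side : Fin n → Bool
  side = proj₁ (max-cut Γ Γ-sym loopless)

  cross : Fin n → ℕ
  cross v = # (λ u → Γ v u ∧ (side v xor side u))

  -- The cut keeps half of `48 * M`. An eighth of `24 * M` is `3 * M`, and rounding down within the
  -- residue class still leaves the `2 * M` that `NearOptimal` asks of `a`.
  24M≤cross : ∀ v → 24 * M ≤ cross v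
  24M≤cross v = *-cancelˡ-≤ 2 (≤-trans (≤-reflexive (eq M))
    (≤-trans (dense v) (proj₂ (max-cut Γ Γ-sym loopless) v)))
    where
    eq : ∀ M → 2 * (24 * M) ≡ 48 * M
    eq = solve-∀

  cross≤deg : ∀ v → cross v ≤ # (Γ v)
  cross≤deg v = #-mono {f = λ u → Γ v u ∧ (side v xor side u)} {Γ v} (λ u p → proj₁ (∧-true p))

  N : Fin n → Fin n → Bool
  N x w = Γ x w ∧ (side x ∧ not (side w))

  abstract
    rowN : ∀ x → side x ≡ true → # (N x) ≡ cross x
    rowN x sx = sum-cong-≗ (λ w → cong (λ s → ⟦ Γ x w ∧ s ⟧) (eq (side x) (side w) sx))
      where
      eq : ∀ s t → s ≡ true → s ∧ not t ≡ s xor t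
      eq true t _ = refl

  colN : Fin n → ℕ
  colN w = # (λ x → N x w)

  colN-cross : ∀ w → side w ≡ false → colN w ≡ cross w
  colN-cross w sw = sum-cong-≗ (λ x → cong ⟦_⟧ (cong₂ _∧_ (Γ-sym x w) (eq (side x) (side w) sw)))
    where
    eq : ∀ s t → t ≡ false → s ∧ not t ≡ t xor s
    eq true  false _ = refl
    eq false false _ = refl

  colN-zero : ∀ w → side w ≡ true → colN w ≡ 0
  colN-zero w sw = sum-zero (λ x → cong ⟦_⟧ (eq (Γ x w) (side x) (side w) sw))
    where
    eq : ∀ g s t → t ≡ true → g ∧ (s ∧ not t) ≡ false
    eq false s     true _ = refl
    eq true  true  true _ = refl
    eq true  false true _ = refl

  row-empty : ∀ x → side x ≡ false → ∀ w → N x w ≡ false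
  row-empty x sx w with Γ x w | side x | sx
  ... | false | _     | _  = refl
  ... | true  | false | _  = refl

  abstract
    column : ∀ w → ∃ λ b → colN w ≤ 8 * b × 8 * b ≤ 2 * colN w × 8 * b ≤ # (Γ w) + 8 * M ×
                           (side w ≡ false → ∃ λ z → b ≡ r w + M * z)
    column w = by-side (side w) refl
      where
      8M≤colN : side w ≡ false → 8 * M ≤ colN w
      8M≤colN sw = subst (8 * M ≤_) (sym (colN-cross w sw))
        (≤-trans (*-monoˡ-≤ M {8} {24} (m≤m+n 8 16)) (24M≤cross w))
      by-side : ∀ s → side w ≡ s → ∃ λ b → colN w ≤ 8 * b × 8 * b ≤ 2 * colN w × 8 * b ≤ # (Γ w) + 8 * M ×
                                           (side w ≡ false → ∃ λ z → b ≡ r w + M * z)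
      by-side true sw  = 0 , ≤-reflexive (colN-zero w sw) , z≤n , z≤n , (λ p → ⊥-elim (false≢true p sw))
      by-side false sw with round-up (r<M w) (colN w)
      ... | z , lo , hi = r w + M * z , lo ,
            ≤-trans (<⇒≤ hi) (≤-trans (+-monoʳ-≤ (colN w) (8M≤colN sw)) (≤-reflexive (cong (colN w +_) (sym (+-identityʳ _))))) ,
            ≤-trans (<⇒≤ hi) (+-monoˡ-≤ (8 * M) (≤-trans (≤-reflexive (colN-cross w sw)) (cross≤deg w))) ,
            (λ _ → z , refl)

  b : Fin n → ℕ
  b w = proj₁ (column w)

  abstract
    extra : ∀ w → ∃ λ g → (∀ x → g x ≡ true → N x w ≡ true) × # g ≡ 8 * b w ∸ colN w
    extra w = choose (λ x → N x w) (8 * b w ∸ colN w)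
      (≤-trans (∸-monoˡ-≤ (colN w) (proj₁ (proj₂ (proj₂ (column w)))))
               (≤-reflexive (trans (cong (λ k → colN w + k ∸ colN w) (+-identityʳ (colN w))) (m+n∸m≡n (colN w) (colN w)))))

  -- Edges of `N` get weight 1 or 2, the doubled ones being chosen so that each column sums to
  -- exactly `8 * b w`. This is possible because `8 * b w` lies between `colN w` and twice that
  -- number.
  q : Fin n → Fin n → ℕ
  q x w = ⟦ N x w ⟧ + ⟦ proj₁ (extra w) x ⟧

  q≤2N : ∀ x w → q x w ≤ 2 * ⟦ N x w ⟧
  q≤2N x w with N x w in Nxw
  ... | true  = +-monoʳ-≤ 1 (⟦⟧≤1 (proj₁ (extra w) x))
  ... | false with proj₁ (extra w) x in gx
  ...   | false = z≤n
  ...   | true  = ⊥-elim (false≢true Nxw (proj₁ (proj₂ (extra w)) x gx))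

  col-q : ∀ w → sum (λ x → q x w) ≡ 8 * b w
  col-q w = begin
    sum (λ x → q x w)             ≡⟨ sum-+ (λ x → ⟦ N x w ⟧) (λ x → ⟦ proj₁ (extra w) x ⟧) ⟩
    colN w + # (proj₁ (extra w))  ≡⟨ cong (colN w +_) (proj₂ (proj₂ (extra w))) ⟩
    colN w + (8 * b w ∸ colN w)   ≡⟨ m+[n∸m]≡n (proj₁ (proj₂ (column w))) ⟩
    8 * b w                       ∎
    where open ≡-Reasoning

  row-q≤2N : ∀ x → sum (q x) ≤ 2 * # (N x)
  row-q≤2N x = ≤-trans (sum-mono-≤ (q≤2N x)) (≤-reflexive (sum-scale 2 (λ w → ⟦ N x w ⟧)))

  Row : Fin n → Set
  Row x = ∃ λ a → 8 * a ≤ sum (q x) × sum (q x) ≤ 8 * (a + M) ×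
                  (2 * M ≤ a ⊎ (∀ w → N x w ≡ false)) × (side x ≡ true → ∃ λ z → a ≡ r x + M * z)

  abstract
    rows : ∀ x → Row x
    rows x = by-side (side x) refl
      where
      result : side x ≡ true → ∀ z → sum (q x) ≤ 8 * (r x + M * z) → 8 * (r x + M * z) < sum (q x) + 8 * M → Row x
      result sx z lo hi = by-z z lo hi
        where
        24M≤q : 24 * M ≤ sum (q x)
        24M≤q = ≤-trans (24M≤cross x) (≤-trans (≤-reflexive (sym (rowN x sx)))
          (sum-mono-≤ (λ w → m≤m+n ⟦ N x w ⟧ _)))
        eq₀ : ∀ r M s k → k ≡ 0 → 8 * suc r + (s + (8 * (r + k) + 8 * M)) + 16 * M ≡
                                  8 * r + (24 * M + (s + 8 * suc r))
        eq₀ r M s _ refl = solve (r ∷ M ∷ s ∷ [])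
        eq₁ : ∀ r M s k k′ → k′ ≡ M + k → 8 * (r + k) + (s + 8 * M) + 1 ≡ s + suc (8 * (r + k′))
        eq₁ r M s k _ refl = solve (r ∷ M ∷ s ∷ k ∷ [])
        eq₂ : ∀ r M k k′ → k′ ≡ M + k → 8 * (r + k′) ≡ 8 * (r + k + M)
        eq₂ r M k _ refl = solve (r ∷ M ∷ k ∷ [])
        eq₃ : ∀ r M s k k′ → k′ ≡ M + k → 8 * (2 * M) + (s + 8 * (r + k′)) + 0 ≡ 8 * (r + k) + (24 * M + s)
        eq₃ r M s k _ refl = solve (r ∷ M ∷ s ∷ k ∷ [])
        by-z : ∀ z → sum (q x) ≤ 8 * (r x + M * z) → 8 * (r x + M * z) < sum (q x) + 8 * M → Row x
        -- `24 * M ≤ sum (q x) ≤ 8 * r x` would contradict `r x < M`.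
        by-z zero lo hi = ⊥-elim (1+n≰n {r x} (*-cancelˡ-≤ 8
          (linear {r = 8 * r x} (16 * M) (24M≤q ⊕ lo ⊕ 8 ⊛ r<M x) (eq₀ (r x) M (sum (q x)) (M * 0) (*-zeroʳ M)))))
        -- The rounded-up value becomes the upper allowed row sum, and its predecessor in the
        -- residue class becomes `a x`.
        by-z (suc z) lo hi = r x + M * z ,
          linear 1 hi (eq₁ (r x) M (sum (q x)) (M * z) (M * suc z) (*-suc M z)) ,
          ≤-trans lo (≤-reflexive (eq₂ (r x) M (M * z) (M * suc z) (*-suc M z))) ,
          inj₁ (*-cancelˡ-≤ 8 (linear 0 (24M≤q ⊕ lo) (eq₃ (r x) M (sum (q x)) (M * z) (M * suc z) (*-suc M z)))) ,
          (λ _ → z , refl)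
      by-side : ∀ s → side x ≡ s → Row x
      by-side false sx = 0 , z≤n , ≤-trans (row-q≤2N x) (≤-trans (≤-reflexive (cong (2 *_) #N≡0)) z≤n) ,
                         inj₂ (row-empty x sx) , (λ p → ⊥-elim (false≢true sx p))
        where
        #N≡0 : # (N x) ≡ 0
        #N≡0 = sum-zero (λ w → cong ⟦_⟧ (row-empty x sx w))
      by-side true sx = result sx (proj₁ up) (proj₁ (proj₂ up)) (proj₂ (proj₂ up))
        where
        up : ∃ λ z → sum (q x) ≤ 8 * (r x + M * z) × 8 * (r x + M * z) < sum (q x) + 8 * M
        up = round-up (r<M x) (sum (q x))

  a : Fin n → ℕ
  a x = proj₁ (rows x)

  Class : Set
  Class = ∃ λ P → Symmetricᵇ P × P ⊆ᵇ Γ × (∀ v → HasResidue M (r v) (# (P v)) × 4 * # (P v) ≤ # (Γ v) + 4 * M)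

  undirect : (∃ λ D → BipartiteSubgraph.Valid N a b M D ×
                (∀ w → # (λ x → D x w) ≤ suc (b w) × b w ≤ suc (# (λ x → D x w)))) → Class
  undirect (D , (D⊆N , row-D) , col-D) = P , P-sym , P⊆Γ , λ v → by-side v (side v) refl
    where
    open Undirect Γ Γ-sym side D D⊆N
    by-side : ∀ v s → side v ≡ s → HasResidue M (r v) (# (P v)) × 4 * # (P v) ≤ # (Γ v) + 4 * M
    by-side v true sv =
      subst Good (sym (deg-row v sv))
        (residue-of-row {M} {r v} {proj₁ a≡} (proj₂ a≡) (row-D v) ,
         small-of-row {M} (row-D v) (proj₁ (proj₂ (rows v))) (row-q≤2N v)
           (≤-trans (≤-reflexive (rowN v sv)) (cross≤deg v)))
      where
      Good : ℕ → Set
      Good p = HasResidue M (r v) p × 4 * p ≤ # (Γ v) + 4 * M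
      a≡ : ∃ λ z → a v ≡ r v + M * z
      a≡ = proj₂ (proj₂ (proj₂ (proj₂ (rows v)))) sv
    by-side v false sv =
      subst Good (sym (deg-col v sv))
        (residue-of-col {M} {r v} {proj₁ b≡} (proj₂ b≡) (col-D v) ,
         small-of-col {M} (proj₁ (col-D v)) (proj₁ (proj₂ (proj₂ (proj₂ (column v)))))
           (≤-trans (*-monoʳ-≤ 48 1≤M) (dense v)))
      where
      Good : ℕ → Set
      Good p = HasResidue M (r v) p × 4 * p ≤ # (Γ v) + 4 * M
      b≡ : ∃ λ z → b v ≡ r v + M * z
      b≡ = proj₂ (proj₂ (proj₂ (proj₂ (column v)))) sv

  abstract
    edge-class : Class
    edge-class = undirect (near-subgraph)
      where
      open NearOptimal N a b M 1≤M q q≤2N col-q (λ x → proj₁ (proj₂ (rows x)))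
        (λ x → proj₁ (proj₂ (proj₂ (rows x)))) (λ x → proj₁ (proj₂ (proj₂ (proj₂ (rows x))))) using (near-subgraph)

-- Vertex colours and their four keys.

does-cong : ∀ {A B : Set} (a? : Dec A) (b? : Dec B) → (A → B) → (B → A) → does a? ≡ does b?
does-cong (yes _) (yes _) _ _ = refl
does-cong (no _)  (no _)  _ _ = refl
does-cong (yes a) (no ¬b) f _ = ⊥-elim (¬b (f a))
does-cong (no ¬a) (yes b) _ g = ⊥-elim (¬a (g b))

does-true : ∀ {A : Set} (a? : Dec A) → does a? ≡ true → A
does-true (yes a) _ = a

true-does : ∀ {A : Set} (a? : Dec A) → A → does a? ≡ true
true-does (yes _) _ = refl
true-does (no ¬a) a = ⊥-elim (¬a a)

sum-≤-const : ∀ n {f : Fin n → ℕ} c → (∀ i → f i ≤ c) → sum f ≤ n * c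
sum-≤-const n c h = ≤-trans (sum-mono-≤ h) (≤-reflexive (sum-const n c))

sum-swap : (g : Fin m → ℕ) (F : Fin m → Fin n → ℕ) →
  sum (λ a → sum (λ u → g u * F u a)) ≡ sum (λ u → g u * sum (F u))
sum-swap g F = trans (∑-comm (λ a u → g u * F u a)) (sum-cong-≗ (λ u → sum-scale (g u) (F u)))

#-∧ : ∀ t (f : Fin n → Bool) → # f ≤ 1 → # (λ i → t ∧ f i) ≤ ⟦ t ⟧
#-∧ {n} false f _ = ≤-reflexive (sum-zero {n} {λ _ → 0} (λ _ → refl))
#-∧ true  f h = h

module Modular (k : ℕ) .{{_ : NonZero k}} where

  %-cong : ∀ {x y} z z′ → x + z * k ≡ y + z′ * k → x % k ≡ y % k
  %-cong {x} {y} z z′ eq = trans (sym ([m+kn]%n≡m%n x z k)) (trans (cong (_% k) eq) ([m+kn]%n≡m%n y z′ k))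

  +-%-cancelˡ : ∀ t {x y} → (t + x) % k ≡ (t + y) % k → x % k ≡ y % k
  +-%-cancelˡ t {x} {y} eq = %-cong ((t + y) / k) ((t + x) / k) (+-cancelˡ-≡ t _ _ (begin
    t + (x + (t + y) / k * k)                            ≡⟨ +-assoc t x _ ⟨
    t + x + (t + y) / k * k                              ≡⟨ cong (_+ (t + y) / k * k) (m≡m%n+[m/n]*n (t + x) k) ⟩
    (t + x) % k + (t + x) / k * k + (t + y) / k * k      ≡⟨ cong (λ r → r + (t + x) / k * k + (t + y) / k * k) eq ⟩
    (t + y) % k + (t + x) / k * k + (t + y) / k * k      ≡⟨ swap ((t + y) % k) _ _ ⟩
    (t + y) % k + (t + y) / k * k + (t + x) / k * k      ≡⟨ cong (_+ (t + x) / k * k) (m≡m%n+[m/n]*n (t + y) k) ⟨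
    t + y + (t + x) / k * k                              ≡⟨ +-assoc t y _ ⟩
    t + (y + (t + x) / k * k)                            ∎))
    where
    open ≡-Reasoning
    swap : ∀ a b c → a + b + c ≡ a + c + b
    swap = solve-∀

-- Colours are triples; the fourth key, their sum modulo k, is determined by the
-- other three, just as one of the four degrees is determined by the others.
module Palette (k : ℕ) .{{_ : NonZero k}} where

  Colour : Set
  Colour = Fin k × Fin k × Fin k

  key : Fin 4 → Colour → ℕ
  key 0F (a , b , c) = toℕ a
  key 1F (a , b , c) = toℕ b
  key 2F (a , b , c) = toℕ c
  key 3F (a , b , c) = (toℕ a + toℕ b + toℕ c) % k

  agree : Fin 4 → Colour → Colour → Bool
  agree i γ δ = does (key i γ ≟ℕ key i δ)

  agree-sym : ∀ i γ δ → agree i γ δ ≡ agree i δ γ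
  agree-sym i γ δ = does-cong (key i γ ≟ℕ key i δ) (key i δ ≟ℕ key i γ) sym sym

  equal : Colour → Colour → Bool
  equal γ δ = (agree 0F γ δ ∧ agree 1F γ δ) ∧ agree 2F γ δ

  cost : Colour → Colour → ℕ
  cost γ δ = sum (λ i → ⟦ agree i γ δ ⟧) + 4 * (k * k) * ⟦ equal γ δ ⟧

  cost-sym : ∀ γ δ → cost γ δ ≡ cost δ γ
  cost-sym γ δ = cong₂ _+_ (sum-cong-≗ (λ i → cong ⟦_⟧ (agree-sym i γ δ)))
    (cong (λ s → 4 * (k * k) * ⟦ s ⟧)
      (cong₂ _∧_ (cong₂ _∧_ (agree-sym 0F γ δ) (agree-sym 1F γ δ)) (agree-sym 2F γ δ)))

  search : {P : Colour → Set} → (∀ γ → Dec (P γ)) → Dec (∃ P)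
  search P? with any? (λ a → any? (λ b → any? (λ c → P? (a , b , c))))
  ... | yes (a , b , c , p) = yes ((a , b , c) , p)
  ... | no ¬p = no λ { ((a , b , c) , p) → ¬p (a , b , c , p) }

  ∑³ : (Colour → ℕ) → ℕ
  ∑³ f = sum (λ a → sum (λ b → sum (λ c → f (a , b , c))))

  ∑³-mono : {f g : Colour → ℕ} → (∀ γ → f γ ≤ g γ) → ∑³ f ≤ ∑³ g
  ∑³-mono h = sum-mono-≤ λ a → sum-mono-≤ λ b → sum-mono-≤ λ c → h (a , b , c)

  ∑³-const : ∀ c → ∑³ (λ _ → c) ≡ k * (k * (k * c))
  ∑³-const c = trans (sum-cong-≗ {k} (λ _ → trans (sum-cong-≗ {k} (λ _ → sum-const k c)) (sum-const k _))) (sum-const k _)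

  ∑³-+ : (f g : Colour → ℕ) → ∑³ (λ γ → f γ + g γ) ≡ ∑³ f + ∑³ g
  ∑³-+ f g = trans (sum-cong-≗ (λ a → trans (sum-cong-≗ (λ b → sum-+ (λ c → f (a , b , c)) (λ c → g (a , b , c))))
    (sum-+ (λ b → sum (λ c → f (a , b , c))) (λ b → sum (λ c → g (a , b , c))))))
    (sum-+ (λ a → sum (λ b → sum (λ c → f (a , b , c)))) (λ a → sum (λ b → sum (λ c → g (a , b , c)))))

  ∑³-scale : ∀ s (f : Colour → ℕ) → ∑³ (λ γ → s * f γ) ≡ s * ∑³ f
  ∑³-scale s f = trans (sum-cong-≗ (λ a → trans (sum-cong-≗ (λ b → sum-scale s (λ c → f (a , b , c))))
    (sum-scale s (λ b → sum (λ c → f (a , b , c))))))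
    (sum-scale s (λ a → sum (λ b → sum (λ c → f (a , b , c)))))

  ∑³-swap : (g : Fin n → ℕ) (F : Fin n → Colour → ℕ) →
    ∑³ (λ γ → sum (λ u → g u * F u γ)) ≡ sum (λ u → g u * ∑³ (F u))
  ∑³-swap g F = trans
    (sum-cong-≗ (λ a → trans (sum-cong-≗ (λ b → sum-swap g (λ u c → F u (a , b , c))))
      (sum-swap g (λ u b → sum (λ c → F u (a , b , c))))))
    (sum-swap g (λ u a → sum (λ b → sum (λ c → F u (a , b , c)))))

  toℕ-unique : ∀ t → # {k} (λ a → does (toℕ a ≟ℕ t)) ≤ 1
  toℕ-unique t = #-unique {k} (λ a → does (toℕ a ≟ℕ t)) λ i j p q → toℕ-injective
    (trans (does-true (toℕ i ≟ℕ t) p) (sym (does-true (toℕ j ≟ℕ t) q)))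

  -- Prescribing one key leaves two free coordinates. For the fourth key, `a` and `b` determine `c`
  -- by cancellation modulo `k`.
  ∑³-agree : ∀ i δ → ∑³ (λ γ → ⟦ agree i γ δ ⟧) ≤ k * (k * 1)
  ∑³-agree 0F δ = ≤-trans (≤-reflexive
      (trans (sum-cong-≗ (λ a → trans (sum-cong-≗ {k} (λ _ → sum-const k ⟦ s a ⟧)) (sum-const k (k * ⟦ s a ⟧))))
        (trans (sum-scale k (λ a → k * ⟦ s a ⟧)) (cong (k *_) (sum-scale k (λ a → ⟦ s a ⟧))))))
      (k ⊛ k ⊛ toℕ-unique _)
    where
    s : Fin k → Bool
    s a = does (toℕ a ≟ℕ key 0F δ)
  ∑³-agree 1F δ = sum-≤-const k (k * 1) (λ a → ≤-trans (≤-reflexive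
      (trans (sum-cong-≗ (λ b → sum-const k ⟦ s b ⟧)) (sum-scale k (λ b → ⟦ s b ⟧))))
      (k ⊛ toℕ-unique _))
    where
    s : Fin k → Bool
    s b = does (toℕ b ≟ℕ key 1F δ)
  ∑³-agree 2F δ = sum-≤-const k (k * 1) (λ a → sum-≤-const k 1 (λ b → toℕ-unique (key 2F δ)))
  ∑³-agree 3F δ = sum-≤-const k (k * 1) (λ a → sum-≤-const k 1 (λ b →
    #-unique {k} (λ c → does ((toℕ a + toℕ b + toℕ c) % k ≟ℕ key 3F δ)) (unique a b)))
    where
    open Modular k
    unique : ∀ a b i j → does ((toℕ a + toℕ b + toℕ i) % k ≟ℕ key 3F δ) ≡ true →
             does ((toℕ a + toℕ b + toℕ j) % k ≟ℕ key 3F δ) ≡ true → i ≡ j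
    unique a b i j p q = toℕ-injective (begin
      toℕ i      ≡⟨ m<n⇒m%n≡m (toℕ<n i) ⟨
      toℕ i % k  ≡⟨ +-%-cancelˡ (toℕ a + toℕ b) (trans (does-true (_ ≟ℕ _) p) (sym (does-true (_ ≟ℕ _) q))) ⟩
      toℕ j % k  ≡⟨ m<n⇒m%n≡m (toℕ<n j) ⟩
      toℕ j      ∎)
      where open ≡-Reasoning

  ∑³-equal : ∀ δ → ∑³ (λ γ → ⟦ equal γ δ ⟧) ≤ 1
  ∑³-equal δ = ≤-trans (sum-mono-≤ (λ a → ≤-trans (sum-mono-≤ (λ b → #-∧ (s a ∧ t b) u (toℕ-unique _)))
      (#-∧ (s a) t (toℕ-unique _)))) (toℕ-unique (key 0F δ))
    where
    s t u : Fin k → Bool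
    s a = does (toℕ a ≟ℕ key 0F δ)
    t b = does (toℕ b ≟ℕ key 1F δ)
    u c = does (toℕ c ≟ℕ key 2F δ)

  -- The penalty for equal colours is met by only one colour, so over all colours it costs no more
  -- than the bound `4 * (k * k)` for the four keys together.
  ∑³-cost : ∀ δ → ∑³ (λ γ → cost γ δ) ≤ 8 * (k * k)
  ∑³-cost δ = begin
    ∑³ (λ γ → cost γ δ)
      ≡⟨ ∑³-+ (λ γ → sum (λ i → ⟦ agree i γ δ ⟧)) (λ γ → 4 * (k * k) * ⟦ equal γ δ ⟧) ⟩
    ∑³ (λ γ → sum (λ i → ⟦ agree i γ δ ⟧)) + ∑³ (λ γ → 4 * (k * k) * ⟦ equal γ δ ⟧)
      ≡⟨ cong₂ _+_ keys (∑³-scale (4 * (k * k)) (λ γ → ⟦ equal γ δ ⟧)) ⟩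
    sum (λ i → ∑³ (λ γ → ⟦ agree i γ δ ⟧)) + 4 * (k * k) * ∑³ (λ γ → ⟦ equal γ δ ⟧)
      ≤⟨ sum-≤-const 4 (k * (k * 1)) (λ i → ∑³-agree i δ) ⊕ (4 * (k * k)) ⊛ ∑³-equal δ ⟩
    4 * (k * (k * 1)) + 4 * (k * k) * 1
      ≡⟨ eq k ⟩
    8 * (k * k) ∎
    where
    open ≤-Reasoning
    eq : ∀ k → 4 * (k * (k * 1)) + 4 * (k * k) * 1 ≡ 8 * (k * k)
    eq = solve-∀
    keys : ∑³ (λ γ → sum (λ i → ⟦ agree i γ δ ⟧)) ≡ sum (λ i → ∑³ (λ γ → ⟦ agree i γ δ ⟧))
    keys = trans (trans
      (sum-cong-≗ (λ a → trans (sum-cong-≗ (λ b → ∑-comm (λ c i → ⟦ agree i (a , b , c) δ ⟧)))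
        (∑-comm (λ b i → sum (λ c → ⟦ agree i (a , b , c) δ ⟧)))))
      (∑-comm (λ a i → sum (λ b → sum (λ c → ⟦ agree i (a , b , c) δ ⟧))))) refl

  abstract
    -- A locally optimal colour costs at most the average over all colours.
    cheap-colouring : (E : Fin n → Fin n → Bool) → Symmetricᵇ E → Looplessᵇ E →
      (∀ v → 2 * # (E v) < k * (k * k)) → Colour →
      ∃ λ (c : Fin n → Colour) → ∀ v → sum (λ u → ⟦ E v u ⟧ * cost (c v) (c u)) < 4 * (k * k)
    cheap-colouring {n} E E-sym loopless sparse γ₀ with locally-optimal search E E-sym loopless cost cost-sym γ₀
    ... | c , optimal = c , λ v → *-cancelˡ-< (k * (k * k)) _ _ (begin-strict
      k * (k * k) * total v              ≡⟨ eq₁ k (total v) ⟩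
      k * (k * (k * total v))            ≡⟨ ∑³-const (total v) ⟨
      ∑³ (λ _ → total v)                 ≤⟨ ∑³-mono (optimal v) ⟩
      ∑³ (λ γ → sum (λ u → ⟦ E v u ⟧ * cost γ (c u)))     ≡⟨ ∑³-swap (λ u → ⟦ E v u ⟧) (λ u γ → cost γ (c u)) ⟩
      sum (λ u → ⟦ E v u ⟧ * ∑³ (λ γ → cost γ (c u)))     ≤⟨ sum-mono-≤ (λ u → ⟦ E v u ⟧ ⊛ ∑³-cost (c u)) ⟩
      sum (λ u → ⟦ E v u ⟧ * (8 * (k * k)))               ≡⟨ *-distribʳ-sum (8 * (k * k)) (λ u → ⟦ E v u ⟧) ⟨
      # (E v) * (8 * (k * k))            ≡⟨ eq₂ (# (E v)) (k * k) ⟩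
      -- Here twice the degree being below the number `k * (k * k)` of colours brings the average
      -- cost below `4 * (k * k)`.
      4 * (k * k) * (2 * # (E v))        <⟨ *-monoʳ-< (4 * (k * k)) {{4k²≢0}} (sparse v) ⟩
      4 * (k * k) * (k * (k * k))        ≡⟨ *-comm (4 * (k * k)) _ ⟩
      k * (k * k) * (4 * (k * k))        ∎)
      where
      open ≤-Reasoning
      total : Fin n → ℕ
      total v = sum (λ u → ⟦ E v u ⟧ * cost (c v) (c u))
      4k²≢0 : NonZero (4 * (k * k))
      4k²≢0 = m*n≢0 4 (k * k) {{_}} {{m*n≢0 k k}}
      eq₁ : ∀ k t → k * (k * k) * t ≡ k * (k * (k * t))
      eq₁ = solve-∀
      eq₂ : ∀ e s → e * (8 * s) ≡ 4 * s * (2 * e)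
      eq₂ = solve-∀

  module Cheap (E : Fin n → Fin n → Bool) (c : Fin n → Colour)
    (cheap : ∀ v → sum (λ u → ⟦ E v u ⟧ * cost (c v) (c u)) < 4 * (k * k)) where

    -- A single edge with equal colours would already cost `4 * (k * k)`.
    proper : ∀ v u → E v u ≡ true → equal (c v) (c u) ≡ false
    proper v u Evu with equal (c v) (c u) in eq
    ... | false = refl
    ... | true  = ⊥-elim (<⇒≱ (cheap v) (≤-trans (≤-trans large (m≤n+m _ _)) (≤-trans (≤-reflexive one)
                    (term≤sum (λ u → ⟦ E v u ⟧ * cost (c v) (c u)) u))))
      where
      large : 4 * (k * k) ≤ 4 * (k * k) * ⟦ equal (c v) (c u) ⟧
      large = ≤-reflexive (sym (trans (cong (λ s → 4 * (k * k) * ⟦ s ⟧) eq) (*-identityʳ _)))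
      one : cost (c v) (c u) ≡ ⟦ E v u ⟧ * cost (c v) (c u)
      one = sym (trans (cong (λ s → ⟦ s ⟧ * cost (c v) (c u)) Evu) (+-identityʳ _))

    -- The cost of an edge charges its agreements in key `i` and in key `3F` separately, so one cost
    -- bound covers both counts together. These are the edges withheld from selection for class `i`.
    few-agree : ∀ i → i ≢ 3F → ∀ v → # (λ u → E v u ∧ agree i (c v) (c u)) +
                                     # (λ u → E v u ∧ agree 3F (c v) (c u)) ≤ 4 * (k * k)
    few-agree i i≢3 v = ≤-trans (≤-reflexive (sym (sum-+ (λ u → ⟦ E v u ∧ agree i (c v) (c u) ⟧) _)))
      (≤-trans (sum-mono-≤ pointwise) (<⇒≤ (cheap v)))
      where
      two : ∀ (f : Fin 4 → ℕ) i → i ≢ 3F → f i + f 3F ≤ sum f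
      two f 0F _ = linear (f 1F + f 2F) (≤-refl {0}) (eq (f 0F) (f 1F) (f 2F) (f 3F))
        where
        eq : ∀ a b c d → a + d + 0 + (b + c) ≡ a + (b + (c + (d + 0))) + 0
        eq = solve-∀
      two f 1F _ = linear (f 0F + f 2F) (≤-refl {0}) (eq (f 0F) (f 1F) (f 2F) (f 3F))
        where
        eq : ∀ a b c d → b + d + 0 + (a + c) ≡ a + (b + (c + (d + 0))) + 0
        eq = solve-∀
      two f 2F _ = linear (f 0F + f 1F) (≤-refl {0}) (eq (f 0F) (f 1F) (f 2F) (f 3F))
        where
        eq : ∀ a b c d → c + d + 0 + (a + b) ≡ a + (b + (c + (d + 0))) + 0
        eq = solve-∀
      two f 3F i≢3 = ⊥-elim (i≢3 refl)
      pointwise : ∀ u → ⟦ E v u ∧ agree i (c v) (c u) ⟧ + ⟦ E v u ∧ agree 3F (c v) (c u) ⟧ ≤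
                        ⟦ E v u ⟧ * cost (c v) (c u)
      pointwise u with E v u
      ... | false = z≤n
      ... | true  = ≤-trans (two (λ j → ⟦ agree j (c v) (c u) ⟧) i i≢3)
                      (≤-trans (m≤m+n _ _) (≤-reflexive (sym (+-identityʳ _))))

-- Numerical bounds on the degree.

cube : ℕ → ℕ
cube j = j * (j * j)

cube-mono : ∀ {i j} → i ≤ j → cube i ≤ cube j
cube-mono i≤j = *-mono-≤ i≤j (*-mono-≤ i≤j i≤j)

cube-root : ∀ D → ∃ λ j → cube j ≤ D × D < cube (suc j)
cube-root zero = 0 , z≤n , s≤s z≤n
cube-root (suc D) with cube-root D
... | j , lo , hi with suc D <? cube (suc j)
...   | yes lt = j , m≤n⇒m≤1+n lo , lt
...   | no ≮   = suc j , ≮⇒≥ ≮ , ≤-trans (s≤s hi) (linear (3 * (suc j * suc j) + 3 * suc j) (≤-refl {0}) (eq (suc j)))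
  where
  eq : ∀ x → suc (x * (x * x)) + 0 + (3 * (x * x) + 3 * x) ≡ suc x * (suc x * suc x) + 0
  eq = solve-∀

-- The factor 46 splits the comparison with `cube j` in two: `16 * suc j + 1400 ≤ 46 * j` and
-- `46 * suc j ≤ j * j`, both valid from 49 on.
large-bound : ∀ {d j} → 49 ≤ j → cube j ≤ 2 * d → 8 * (suc j * suc j) + 700 * suc j ≤ d
large-bound {d} {j} 49≤j lo = *-cancelˡ-≤ 2 (begin
  2 * (8 * (suc j * suc j) + 700 * suc j)  ≡⟨ factor (suc j) 700 ⟩
  suc j * (16 * suc j + 2 * 700)           ≤⟨ *-monoʳ-≤ (suc j) first ⟩
  suc j * (46 * j)                         ≡⟨ swap (suc j) 46 j ⟩
  j * (46 * suc j)                         ≤⟨ *-monoʳ-≤ j second ⟩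
  j * (j * j)                              ≤⟨ lo ⟩
  2 * d                                    ∎)
  where
  open ≤-Reasoning
  factor : ∀ k c → 2 * (8 * (k * k) + c * k) ≡ k * (16 * k + 2 * c)
  factor = solve-∀
  swap : ∀ k c j → k * (c * j) ≡ j * (c * k)
  swap = solve-∀
  first : 16 * suc j + 2 * 700 ≤ 46 * j
  first = linear 0 (≤-trans (≤ᵇ⇒≤ (2 * 700 + 16) (30 * 49) _) (*-monoʳ-≤ 30 49≤j)) (eq j (2 * 700))
    where
    eq : ∀ j c → 16 * suc j + c + 30 * j + 0 ≡ 46 * j + (c + 16)
    eq = solve-∀
  second : 46 * suc j ≤ j * j
  second = ≤-trans (linear 0 (≤-trans (≤ᵇ⇒≤ 46 49 _) 49≤j) (eq j))
                   (*-monoˡ-≤ j (≤-trans (≤ᵇ⇒≤ 47 49 _) 49≤j))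
    where
    eq : ∀ j → 46 * suc j + j + 0 ≡ 47 * j + 46
    eq = solve-∀

degree-bound : ∀ d → 54000 ≤ d → ∀ j → cube j ≤ 2 * d → 2 * d < cube (suc j) →
               8 * (suc j * suc j) + 700 * suc j ≤ d
degree-bound d 54000≤d j lo hi with 49 ≤? j | j ≟ℕ 48 | j ≟ℕ 47
... | yes 49≤j | _        | _        = large-bound 49≤j lo
-- The two borderline values of `j` are computed: the left-hand side is 53508 for 48 and 52032 for
-- 47.
... | no _     | yes refl | _        = ≤-trans (≤ᵇ⇒≤ (8 * (49 * 49) + 700 * 49) 54000 _) 54000≤d
... | no _     | no _     | yes refl = ≤-trans (≤ᵇ⇒≤ (8 * (48 * 48) + 700 * 48) 54000 _) 54000≤d
-- Smaller `j` cannot occur: the cube of 47 is 103823, below 108000.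
... | no 49≰j  | no j≢48  | no j≢47  = ⊥-elim (<⇒≱ hi (≤-trans (cube-mono j<47)
        (≤-trans (≤ᵇ⇒≤ (cube 47) (2 * 54000) _) (2 ⊛ 54000≤d))))
  where
  j<47 : j < 47
  j<47 = ≤∧≢⇒< (s≤s⁻¹ (≤∧≢⇒< (s≤s⁻¹ (≰⇒> 49≰j)) j≢48)) j≢47

-- Assembling the four classes.

module Separation (k : ℕ) .{{_ : NonZero k}} where

  -- Reducing `D` modulo 7 recovers the error, since it is at most 6; what remains, divided by 7,
  -- gives `T` modulo `k`. The factor 7 is sized for the fourth class, where three shifted errors of
  -- at most 2 accumulate.
  separate : ∀ {T T′ e e′ D Y Y′ Z Z′} → e ≤ 6 → e′ ≤ 6 →
    D + 7 * k * Y ≡ 7 * T + e + 7 * k * Z → D + 7 * k * Y′ ≡ 7 * T′ + e′ + 7 * k * Z′ → T % k ≡ T′ % k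
  separate {T} {T′} {e} {e′} {D} {Y} {Y′} {Z} {Z′} e≤6 e′≤6 eq eq′ =
    Modular.%-cong k (Z + Y′) (Z′ + Y) (*-cancelʳ-≡ _ _ 7 (+-cancelˡ-≡ e _ _
      (trans both (cong (_+ (T′ + (Z′ + Y) * k) * 7) (sym e≡e′)))))
    where
    open ≡-Reasoning
    left : ∀ k T e Z Y′ → e + (T + (Z + Y′) * k) * 7 ≡ (7 * T + e + 7 * k * Z) + 7 * k * Y′
    left = solve-∀
    middle : ∀ k D Y Y′ → (D + 7 * k * Y) + 7 * k * Y′ ≡ (D + 7 * k * Y′) + 7 * k * Y
    middle = solve-∀
    both : e + (T + (Z + Y′) * k) * 7 ≡ e′ + (T′ + (Z′ + Y) * k) * 7
    both = begin
      e + (T + (Z + Y′) * k) * 7                ≡⟨ left k T e Z Y′ ⟩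
      (7 * T + e + 7 * k * Z) + 7 * k * Y′      ≡⟨ cong (_+ 7 * k * Y′) eq ⟨
      (D + 7 * k * Y) + 7 * k * Y′              ≡⟨ middle k D Y Y′ ⟩
      (D + 7 * k * Y′) + 7 * k * Y              ≡⟨ cong (_+ 7 * k * Y) eq′ ⟩
      (7 * T′ + e′ + 7 * k * Z′) + 7 * k * Y    ≡⟨ left k T′ e′ Z′ Y ⟨
      e′ + (T′ + (Z′ + Y) * k) * 7              ∎
    e≡e′ : e ≡ e′
    e≡e′ = trans (sym (m<n⇒m%n≡m (s≤s e≤6)))
      (trans (Modular.%-cong 7 (T + (Z + Y′) * k) (T′ + (Z′ + Y) * k) both) (m<n⇒m%n≡m (s≤s e′≤6)))

-- An edge whose ends agree in the fourth key has to avoid class 3F, so its class is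
-- fixed in advance; any other edge goes to the stage that selects it, else to 3F.
forced : Bool → Bool → Fin 4
forced a₀ a₁ = if a₀ then (if a₁ then 2F else 1F) else 0F

class : Bool → Fin 4 → Bool → Bool → Bool → Fin 4
class a₃ f p₀ p₁ p₂ = if a₃ then f else if p₀ then 0F else if p₁ then 1F else if p₂ then 2F else 3F

is : Fin 4 → Fin 4 → Bool
is i j = does (j ≟ i)

class-partition : ∀ e j → sum {4} (λ i → ⟦ e ∧ is i j ⟧) ≡ ⟦ e ⟧
class-partition false _ = refl
class-partition true 0F = refl
class-partition true 1F = refl
class-partition true 2F = refl
class-partition true 3F = refl

module Stages {n : ℕ} (E : Fin n → Fin n → Bool) (E-sym : Symmetricᵇ E) (loopless : Looplessᵇ E)
  (d : ℕ) (regular : ∀ v → # (E v) ≡ d) (j : ℕ) (bound : 8 * (suc j * suc j) + 700 * suc j ≤ d)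
  (c : Fin n → Palette.Colour (suc j))
  (cheap : ∀ v → sum (λ u → ⟦ E v u ⟧ * Palette.cost (suc j) (c v) (c u)) < 4 * (suc j * suc j)) where

  k M : ℕ
  k = suc j
  M = 7 * k

  open Palette k using (key; agree; agree-sym; equal)
  open Palette.Cheap k E c cheap

  A : Fin 4 → Fin n → Fin n → Bool
  A i u v = agree i (c u) (c v)

  A-sym : ∀ i → Symmetricᵇ (A i)
  A-sym i u v = agree-sym i (c u) (c v)

  -- A congruence modulo `M`, with multiples on both sides in place of subtraction; as in
  -- `HasResidue`, the error is `e - 1`.
  Hit : Fin 4 → Fin n → ℕ → Set
  Hit i v D = ∃ λ e → ∃ λ y → ∃ λ z → e ≤ 2 × suc D + M * y ≡ 7 * key i (c v) + e + M * z

  free : Fin 4 → (Fin n → Fin n → Bool) → Fin n → Fin n → Bool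
  free i prev u v = E u v ∧ (not (A 3F u v ∨ A i u v) ∧ not (prev u v))

  Selection : Fin 4 → (Fin n → Fin n → Bool) → (Fin n → ℕ) → Set
  Selection i prev B = ∃ λ P → Symmetricᵇ P × P ⊆ᵇ free i prev ×
                               (∀ v → Hit i v (B v + # (P v)) × 4 * # (P v) ≤ d + 4 * M)

  stage : ∀ i → i ≢ 3F → ∀ prev → Symmetricᵇ prev → (∀ v → 4 * # (prev v) ≤ 2 * (d + 4 * M)) →
          (B : Fin n → ℕ) → Selection i prev B
  stage i i≢3 prev prev-sym prev-small B =
    select (EdgeClass.edge-class Γ Γ-sym Γ-loopless M (s≤s z≤n) dense r (λ v → m%n<n (target v) M))
    where
    Γ : Fin n → Fin n → Bool
    Γ = free i prev
    Γ-sym : Symmetricᵇ Γ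
    Γ-sym u v = cong₂ _∧_ (E-sym u v)
      (cong₂ _∧_ (cong not (cong₂ _∨_ (A-sym 3F u v) (A-sym i u v))) (cong not (prev-sym u v)))
    Γ-loopless : Looplessᵇ Γ
    Γ-loopless v = cong (_∧ (not (A 3F v v ∨ A i v v) ∧ not (prev v v))) (loopless v)
    -- `j + 6 * k` is one less than `M` and so acts as -1. The target is thus
    -- `7 * key i (c v) - B v` modulo `M`, because the forced edges already contribute `B v` to the
    -- degree.
    target r : Fin n → ℕ
    target v = 7 * key i (c v) + (j + 6 * k) * B v
    r v = target v % M
    deg-split : ∀ v → d ≤ # (Γ v) + (# (λ u → E v u ∧ A i v u) + # (λ u → E v u ∧ A 3F v u) + # (prev v))
    deg-split v = subst₂ _≤_ (regular v)
      (trans (sum-+ (λ u → ⟦ Γ v u ⟧) (λ u → ⟦ E v u ∧ A i v u ⟧ + ⟦ E v u ∧ A 3F v u ⟧ + ⟦ prev v u ⟧))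
        (cong (# (Γ v) +_) (trans (sum-+ (λ u → ⟦ E v u ∧ A i v u ⟧ + ⟦ E v u ∧ A 3F v u ⟧) (λ u → ⟦ prev v u ⟧))
          (cong (_+ # (prev v)) (sum-+ (λ u → ⟦ E v u ∧ A i v u ⟧) (λ u → ⟦ E v u ∧ A 3F v u ⟧))))))
      (sum-mono-≤ (λ u → pointwise (E v u) (A 3F v u) (A i v u) (prev v u)))
      where
      pointwise : ∀ e a b p → ⟦ e ⟧ ≤ ⟦ e ∧ (not (a ∨ b) ∧ not p) ⟧ + (⟦ e ∧ b ⟧ + ⟦ e ∧ a ⟧ + ⟦ p ⟧)
      pointwise false _     _     _     = z≤n
      pointwise true  true  true  _     = s≤s z≤n
      pointwise true  true  false _     = s≤s z≤n
      pointwise true  false true  _     = s≤s z≤n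
      pointwise true  false false true  = s≤s z≤n
      pointwise true  false false false = s≤s z≤n
    dense : ∀ v → 48 * M ≤ # (Γ v)
    -- This is where 700 comes from. Of `4 * d`, agreements take at most `16 * (k * k)` and earlier
    -- classes `2 * d + 56 * k`; since `2 * d` is at least `16 * (k * k) + 1400 * k`, there remains
    -- `1344 * k`, which is `4 * (48 * M)`.
    dense v = *-cancelˡ-≤ 4 (linear 0
      (4 ⊛ deg-split v ⊕ 4 ⊛ few-agree i i≢3 v ⊕ prev-small v ⊕ 2 ⊛ bound)
      (eq k d (# (Γ v)) (# (λ u → E v u ∧ A i v u) + # (λ u → E v u ∧ A 3F v u)) (# (prev v))))
      where
      eq : ∀ k d g s p →
        4 * (48 * (7 * k)) + (4 * (g + (s + p)) + (4 * (4 * (k * k)) + (2 * (d + 4 * (7 * k)) + 2 * d))) + 0 ≡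
        4 * g + (4 * d + (4 * s + (4 * p + 2 * (8 * (k * k) + 700 * k))))
      eq = solve-∀
    select : (∃ λ P → Symmetricᵇ P × P ⊆ᵇ Γ ×
               (∀ v → HasResidue M (r v) (# (P v)) × 4 * # (P v) ≤ # (Γ v) + 4 * M)) → Selection i prev B
    select (P , P-sym , P⊆Γ , good) = P , P-sym , P⊆Γ , λ v → hit v , ≤-trans (proj₂ (good v)) (+-monoˡ-≤ (4 * M)
        (≤-trans (#-mono {f = Γ v} {E v} (λ u p → proj₁ (∧-true p))) (≤-reflexive (regular v))))
      where
      hit : ∀ v → Hit i v (B v + # (P v))
      hit v with proj₁ (good v)
      ... | z , e , e≤2 , eq = e , target v / M , B v + z , e≤2 ,
            combine (j + 6 * k) (7 * key i (c v)) (B v) (# (P v)) (r v) (target v / M) z e (m≡m%n+[m/n]*n (target v) M) eq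
        where
        combine : ∀ m κ B p r x z e → κ + m * B ≡ r + x * suc m → suc p ≡ r + suc m * z + e →
                  suc (B + p) + suc m * x ≡ κ + e + suc m * (B + z)
        combine m κ B p r x z e eq₁ eq₂ = begin
          suc (B + p) + suc m * x                  ≡⟨ shuffle m B (suc p) x (suc (B + p)) (sym (+-suc B p)) ⟩
          B + suc p + x * suc m                    ≡⟨ cong (λ t → B + t + x * suc m) eq₂ ⟩
          B + (r + suc m * z + e) + x * suc m      ≡⟨ solve (B ∷ r ∷ m ∷ z ∷ e ∷ x ∷ []) ⟩
          (r + x * suc m) + (B + suc m * z + e)    ≡⟨ cong (_+ (B + suc m * z + e)) eq₁ ⟨
          (κ + m * B) + (B + suc m * z + e)        ≡⟨ solve (κ ∷ m ∷ B ∷ z ∷ e ∷ []) ⟩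
          κ + e + suc m * (B + z)                  ∎
          where
          open ≡-Reasoning
          shuffle : ∀ m B p x q → q ≡ B + p → q + suc m * x ≡ B + p + x * suc m
          shuffle m B p x _ refl = solve (m ∷ B ∷ p ∷ x ∷ [])

  f : Fin n → Fin n → Fin 4
  f u v = forced (A 0F u v) (A 1F u v)

  B : Fin 4 → Fin n → ℕ
  B i v = # (λ u → E v u ∧ (A 3F v u ∧ is i (f v u)))

  module Classes
    (S₀ : Selection 0F (λ _ _ → false) (B 0F))
    (S₁ : Selection 1F (proj₁ S₀) (B 1F))
    (S₂ : Selection 2F (λ u v → proj₁ S₀ u v ∨ proj₁ S₁ u v) (B 2F)) where

    P₀ P₁ P₂ : Fin n → Fin n → Bool
    P₀ = proj₁ S₀
    P₁ = proj₁ S₁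
    P₂ = proj₁ S₂

    χ : Fin n → Fin n → Fin 4
    χ u v = class (A 3F u v) (f u v) (P₀ u v) (P₁ u v) (P₂ u v)

    χ-sym : ∀ u v → χ u v ≡ χ v u
    χ-sym u v rewrite A-sym 3F u v | A-sym 0F u v | A-sym 1F u v
      | proj₁ (proj₂ S₀) u v | proj₁ (proj₂ S₁) u v | proj₁ (proj₂ S₂) u v = refl

    deg : Fin 4 → Fin n → ℕ
    deg i v = # (λ u → E v u ∧ is i (χ v u))

    deg-sum : ∀ v → sum (λ i → deg i v) ≡ d
    deg-sum v = trans (∑-comm (λ i u → ⟦ E v u ∧ is i (χ v u) ⟧))
      (trans (sum-cong-≗ (λ u → class-partition (E v u) (χ v u))) (regular v))

    unpack : ∀ e a b p → e ∧ (not (a ∨ b) ∧ not p) ≡ true → e ≡ true × a ≡ false × b ≡ false × p ≡ false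
    unpack true false false false _ = refl , refl , refl , refl

    in₀ : ∀ u v → P₀ u v ≡ true → E u v ≡ true × A 3F u v ≡ false × A 0F u v ≡ false × false ≡ false
    in₀ u v p = unpack (E u v) (A 3F u v) (A 0F u v) false (proj₁ (proj₂ (proj₂ S₀)) u v p)

    in₁ : ∀ u v → P₁ u v ≡ true → E u v ≡ true × A 3F u v ≡ false × A 1F u v ≡ false × P₀ u v ≡ false
    in₁ u v p = unpack (E u v) (A 3F u v) (A 1F u v) (P₀ u v) (proj₁ (proj₂ (proj₂ S₁)) u v p)

    in₂ : ∀ u v → P₂ u v ≡ true → E u v ≡ true × A 3F u v ≡ false × A 2F u v ≡ false × P₀ u v ∨ P₁ u v ≡ false
    in₂ u v p = unpack (E u v) (A 3F u v) (A 2F u v) (P₀ u v ∨ P₁ u v) (proj₁ (proj₂ (proj₂ S₂)) u v p)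

    split-sum : ∀ i v (P : Fin n → Fin n → Bool) →
      (∀ u → ⟦ E v u ∧ is i (χ v u) ⟧ ≡ ⟦ E v u ∧ (A 3F v u ∧ is i (f v u)) ⟧ + ⟦ P v u ⟧) →
      deg i v ≡ B i v + # (P v)
    split-sum i v P h = trans (sum-cong-≗ h)
      (sum-+ (λ u → ⟦ E v u ∧ (A 3F v u ∧ is i (f v u)) ⟧) (λ u → ⟦ P v u ⟧))

    -- Forced edges agree in the fourth key and selected edges do not, so the two counts do not
    -- overlap.
    deg₀ : ∀ v → deg 0F v ≡ B 0F v + # (P₀ v)
    deg₀ v = split-sum 0F v P₀ λ u → eq (E v u) (A 3F v u) (f v u) (P₀ v u) (P₁ v u) (P₂ v u)
      (λ p → proj₁ (in₀ v u p) , proj₁ (proj₂ (in₀ v u p)))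
      where
      eq : ∀ e a f p q r → (p ≡ true → e ≡ true × a ≡ false) →
        ⟦ e ∧ is 0F (class a f p q r) ⟧ ≡ ⟦ e ∧ (a ∧ is 0F f) ⟧ + ⟦ p ⟧
      eq true  false f true  q r h = refl
      eq true  true  f true  q r h with () ← proj₂ (h refl)
      eq false a     f true  q r h with () ← proj₁ (h refl)
      eq false a     f false q r h = refl
      eq true  true  f false q r h = sym (+-identityʳ _)
      eq true  false f false true  r     h = refl
      eq true  false f false false true  h = refl
      eq true  false f false false false h = refl

    -- In addition, this stage selects only among edges left by the previous one, so the order of
    -- the tests in `class` takes none of its edges away.
    deg₁ : ∀ v → deg 1F v ≡ B 1F v + # (P₁ v)
    deg₁ v = split-sum 1F v P₁ λ u → eq (E v u) (A 3F v u) (f v u) (P₀ v u) (P₁ v u) (P₂ v u)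
      (λ p → proj₁ (in₁ v u p) , proj₁ (proj₂ (in₁ v u p)) , proj₂ (proj₂ (proj₂ (in₁ v u p))))
      where
      eq : ∀ e a f p q r → (q ≡ true → e ≡ true × a ≡ false × p ≡ false) →
        ⟦ e ∧ is 1F (class a f p q r) ⟧ ≡ ⟦ e ∧ (a ∧ is 1F f) ⟧ + ⟦ q ⟧
      eq true  false f false true  r h = refl
      eq true  false f true  true  r h with () ← proj₂ (proj₂ (h refl))
      eq true  true  f p     true  r h with () ← proj₁ (proj₂ (h refl))
      eq false a     f p     true  r h with () ← proj₁ (h refl)
      eq false a     f p     false r h = refl
      eq true  true  f p     false r h = sym (+-identityʳ _)
      eq true  false f true  false r     h = refl
      eq true  false f false false true  h = refl
      eq true  false f false false false h = refl

    deg₂ : ∀ v → deg 2F v ≡ B 2F v + # (P₂ v)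
    deg₂ v = split-sum 2F v P₂ λ u → eq (E v u) (A 3F v u) (f v u) (P₀ v u) (P₁ v u) (P₂ v u)
      (λ p → proj₁ (in₂ v u p) , proj₁ (proj₂ (in₂ v u p)) , proj₂ (proj₂ (proj₂ (in₂ v u p))))
      where
      eq : ∀ e a f p q r → (r ≡ true → e ≡ true × a ≡ false × p ∨ q ≡ false) →
        ⟦ e ∧ is 2F (class a f p q r) ⟧ ≡ ⟦ e ∧ (a ∧ is 2F f) ⟧ + ⟦ r ⟧
      eq true  false f false false true h = refl
      eq true  false f true  q     true h with () ← proj₂ (proj₂ (h refl))
      eq true  false f false true  true h with () ← proj₂ (proj₂ (h refl))
      eq true  true  f p     q     true h with () ← proj₁ (proj₂ (h refl))
      eq false a     f p     q     true h with () ← proj₁ (h refl)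
      eq false a     f p     q     false h = refl
      eq true  true  f p     q     false h = sym (+-identityʳ _)
      eq true  false f true  q     false h = refl
      eq true  false f false true  false h = refl
      eq true  false f false false false h = refl

    hit₀ : ∀ v → Hit 0F v (deg 0F v)
    hit₀ v = subst (Hit 0F v) (sym (deg₀ v)) (proj₁ (proj₂ (proj₂ (proj₂ S₀)) v))

    hit₁ : ∀ v → Hit 1F v (deg 1F v)
    hit₁ v = subst (Hit 1F v) (sym (deg₁ v)) (proj₁ (proj₂ (proj₂ (proj₂ S₁)) v))

    hit₂ : ∀ v → Hit 2F v (deg 2F v)
    hit₂ v = subst (Hit 2F v) (sym (deg₂ v)) (proj₁ (proj₂ (proj₂ (proj₂ S₂)) v))

    -- A forced edge goes to a class whose key tells its ends apart, a selected edge comes from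
    -- `free`, and a leftover edge disagrees in the fourth key since it was not forced.
    χ⇒disagree : ∀ u v → E u v ≡ true → A (χ u v) u v ≡ false
    χ⇒disagree u v Euv = by-cases (A 3F u v) (A 0F u v) (A 1F u v) (P₀ u v) (P₁ u v) (P₂ u v) refl refl refl refl refl refl
      where
      by-cases : ∀ a₃ a₀ a₁ p₀ p₁ p₂ → A 3F u v ≡ a₃ → A 0F u v ≡ a₀ → A 1F u v ≡ a₁ →
        P₀ u v ≡ p₀ → P₁ u v ≡ p₁ → P₂ u v ≡ p₂ → A (class a₃ (forced a₀ a₁) p₀ p₁ p₂) u v ≡ false
      by-cases true  false _     _ _ _ _ eq₀ _   _ _ _ = eq₀
      by-cases true  true  false _ _ _ _ _   eq₁ _ _ _ = eq₁
      -- Ends that agree in keys `0F` and `1F` must differ in `2F`, because the colouring is proper.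
      by-cases true  true  true  _ _ _ _ eq₀ eq₁ _ _ _ =
        subst₂ (λ s t → (s ∧ t) ∧ A 2F u v ≡ false) eq₀ eq₁ (proper u v Euv)
      by-cases false _ _ true  _     _     _   _ _ h _ _ = proj₁ (proj₂ (proj₂ (in₀ u v h)))
      by-cases false _ _ false true  _     _   _ _ _ h _ = proj₁ (proj₂ (proj₂ (in₁ u v h)))
      by-cases false _ _ false false true  _   _ _ _ _ h = proj₁ (proj₂ (proj₂ (in₂ u v h)))
      by-cases false _ _ false false false eq₃ _ _ _ _ _ = eq₃

    same-key : ∀ i u v → Hit i u (deg i u) → Hit i v (deg i v) → deg i u ≡ deg i v →
               key i (c u) % k ≡ key i (c v) % k
    same-key i u v (e , y , z , e≤2 , eq) (e′ , y′ , z′ , e′≤2 , eq′) same =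
      Separation.separate k {key i (c u)} {key i (c v)} {e} {e′} {suc (deg i v)} {y} {y′} {z} {z′} (≤-trans e≤2 (m≤m+n 2 4)) (≤-trans e′≤2 (m≤m+n 2 4))
        (trans (cong (λ D → suc D + M * y) (sym same)) eq) eq′

    small-key : ∀ (a b : Fin k) → toℕ a % k ≡ toℕ b % k → toℕ a ≡ toℕ b
    small-key a b eq = trans (sym (m<n⇒m%n≡m (toℕ<n a))) (trans eq (m<n⇒m%n≡m (toℕ<n b)))

    add-hits : ∀ D D′ y y′ κ κ′ e e′ z z′ →
      D + M * y ≡ 7 * κ + e + M * z → D′ + M * y′ ≡ 7 * κ′ + e′ + M * z′ →
      D + D′ + M * (y + y′) ≡ 7 * (κ + κ′) + (e + e′) + M * (z + z′)
    add-hits D D′ y y′ κ κ′ e e′ z z′ eq eq′ = begin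
      D + D′ + M * (y + y′)                            ≡⟨ left M D D′ y y′ ⟩
      (D + M * y) + (D′ + M * y′)                      ≡⟨ cong₂ _+_ eq eq′ ⟩
      (7 * κ + e + M * z) + (7 * κ′ + e′ + M * z′)     ≡⟨ right M κ κ′ e e′ z z′ ⟩
      7 * (κ + κ′) + (e + e′) + M * (z + z′)           ∎
      where
      open ≡-Reasoning
      left : ∀ M D D′ y y′ → D + D′ + M * (y + y′) ≡ (D + M * y) + (D′ + M * y′)
      left = solve-∀
      right : ∀ M κ κ′ e e′ z z′ → (7 * κ + e + M * z) + (7 * κ′ + e′ + M * z′) ≡
                                   7 * (κ + κ′) + (e + e′) + M * (z + z′)
      right = solve-∀

    three : Fin n → ℕ
    three v = suc (deg 0F v) + suc (deg 1F v) + suc (deg 2F v)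

    sum-hit : ∀ v → ∃ λ e → ∃ λ y → ∃ λ z → e ≤ 6 ×
      three v + M * y ≡ 7 * (key 0F (c v) + key 1F (c v) + key 2F (c v)) + e + M * z
    sum-hit v = add (hit₀ v) (hit₁ v) (hit₂ v)
      where
      add : Hit 0F v (deg 0F v) → Hit 1F v (deg 1F v) → Hit 2F v (deg 2F v) → _
      add (e₀ , y₀ , z₀ , e₀≤2 , eq₀) (e₁ , y₁ , z₁ , e₁≤2 , eq₁) (e₂ , y₂ , z₂ , e₂≤2 , eq₂) =
        e₀ + e₁ + e₂ , y₀ + y₁ + y₂ , z₀ + z₁ + z₂ , (e₀≤2 ⊕ e₁≤2) ⊕ e₂≤2 ,
        add-hits (suc (deg 0F v) + suc (deg 1F v)) (suc (deg 2F v)) (y₀ + y₁) y₂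
          (key 0F (c v) + key 1F (c v)) (key 2F (c v)) (e₀ + e₁) e₂ (z₀ + z₁) z₂
          (add-hits (suc (deg 0F v)) (suc (deg 1F v)) y₀ y₁ (key 0F (c v)) (key 1F (c v)) e₀ e₁ z₀ z₁ eq₀ eq₁) eq₂

    -- Regularity enters here: the degree in the last class determines the sum of the other three.
    three-cong : ∀ u v → deg 3F u ≡ deg 3F v → three u ≡ three v
    three-cong u v same = cancel (deg 0F u) (deg 1F u) (deg 2F u) (deg 0F v) (deg 1F v) (deg 2F v)
      same (trans (deg-sum u) (sym (deg-sum v)))
      where
      reassoc : ∀ a b c x → suc a + suc b + suc c + x ≡ 3 + (a + (b + (c + (x + 0))))
      reassoc = solve-∀
      cancel : ∀ a b c a′ b′ c′ {x x′} → x ≡ x′ → a + (b + (c + (x + 0))) ≡ a′ + (b′ + (c′ + (x′ + 0))) →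
               suc a + suc b + suc c ≡ suc a′ + suc b′ + suc c′
      cancel a b c a′ b′ c′ {x} refl eq = +-cancelʳ-≡ x _ _
        (trans (reassoc a b c x) (trans (cong (3 +_) eq) (sym (reassoc a′ b′ c′ x))))

    -- For the first three classes `separate` recovers the key, which is already below `k`. For the
    -- last one it is applied to the sum of the other three degrees and recovers the sum of their
    -- keys modulo `k`, which is the fourth key.
    deg-agree : ∀ i u v → deg i u ≡ deg i v → A i u v ≡ true
    deg-agree 0F u v same = true-does (key 0F (c u) ≟ℕ key 0F (c v))
      (small-key (proj₁ (c u)) (proj₁ (c v)) (same-key 0F u v (hit₀ u) (hit₀ v) same))
    deg-agree 1F u v same = true-does (key 1F (c u) ≟ℕ key 1F (c v))
      (small-key (proj₁ (proj₂ (c u))) (proj₁ (proj₂ (c v))) (same-key 1F u v (hit₁ u) (hit₁ v) same))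
    deg-agree 2F u v same = true-does (key 2F (c u) ≟ℕ key 2F (c v))
      (small-key (proj₂ (proj₂ (c u))) (proj₂ (proj₂ (c v))) (same-key 2F u v (hit₂ u) (hit₂ v) same))
    deg-agree 3F u v same = true-does (key 3F (c u) ≟ℕ key 3F (c v))
      (same-sum (sum-hit u) (sum-hit v))
      where
      total : Fin n → ℕ
      total w = key 0F (c w) + key 1F (c w) + key 2F (c w)
      Sum : Fin n → Set
      Sum w = ∃ λ e → ∃ λ y → ∃ λ z → e ≤ 6 ×
        three w + M * y ≡ 7 * total w + e + M * z
      same-sum : Sum u → Sum v → key 3F (c u) ≡ key 3F (c v)
      same-sum (e , y , z , e≤6 , eq) (e′ , y′ , z′ , e′≤6 , eq′) =
        Separation.separate k {total u} {total v} {e} {e′} {three v} {y} {y′} {z} {z′} e≤6 e′≤6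
          (trans (cong (_+ M * y) (sym (three-cong u v same))) eq) eq′

    irregular : ∀ u v → E u v ≡ true → deg (χ u v) u ≢ deg (χ u v) v
    irregular u v Euv same = false≢true (χ⇒disagree u v Euv) (deg-agree (χ u v) u v same)

  Classification : Set
  Classification = ∃ λ (χ : Fin n → Fin n → Fin 4) → (∀ u v → χ u v ≡ χ v u) ×
    (∀ u v → E u v ≡ true →
       # (λ w → E u w ∧ is (χ u v) (χ u w)) ≢ # (λ w → E v w ∧ is (χ u v) (χ v w)))

  small : ∀ i prev B (S : Selection i prev B) v → 4 * # (proj₁ S v) ≤ d + 4 * M
  small _ _ _ (_ , _ , _ , good) v = proj₂ (good v)

  classify₂ : (S₀ : Selection 0F (λ _ _ → false) (B 0F)) (S₁ : Selection 1F (proj₁ S₀) (B 1F)) →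
              Selection 2F (λ u v → proj₁ S₀ u v ∨ proj₁ S₁ u v) (B 2F) → Classification
  classify₂ S₀ S₁ S₂ = χ , χ-sym , irregular
    where open Classes S₀ S₁ S₂

  union-small : (P Q : Fin n → Fin n → Bool) → (∀ v → 4 * # (P v) ≤ d + 4 * M) → (∀ v → 4 * # (Q v) ≤ d + 4 * M) →
    ∀ v → 4 * # (λ u → P v u ∨ Q v u) ≤ 2 * (d + 4 * M)
  union-small P Q small-P small-Q v = linear 0 (4 ⊛ union ⊕ small-P v ⊕ small-Q v)
    (eq (# (λ u → P v u ∨ Q v u)) (# (P v)) (# (Q v)) (d + 4 * M))
    where
    pointwise : ∀ s t → ⟦ s ∨ t ⟧ ≤ ⟦ s ⟧ + ⟦ t ⟧
    pointwise true  t = s≤s z≤n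
    pointwise false t = ≤-refl
    union : # (λ u → P v u ∨ Q v u) ≤ # (P v) + # (Q v)
    union = subst (# (λ u → P v u ∨ Q v u) ≤_) (sum-+ (λ u → ⟦ P v u ⟧) (λ u → ⟦ Q v u ⟧))
      (sum-mono-≤ (λ u → pointwise (P v u) (Q v u)))
    eq : ∀ p p₀ p₁ D → 4 * p + (4 * (p₀ + p₁) + (D + D)) + 0 ≡ 2 * D + (4 * p + (4 * p₀ + 4 * p₁))
    eq = solve-∀

  classify₁ : (S₀ : Selection 0F (λ _ _ → false) (B 0F)) → Selection 1F (proj₁ S₀) (B 1F) → Classification
  classify₁ S₀ S₁ = classify₂ S₀ S₁ (stage 2F (λ ()) (λ u v → proj₁ S₀ u v ∨ proj₁ S₁ u v)
    (λ u v → cong₂ _∨_ (proj₁ (proj₂ S₀) u v) (proj₁ (proj₂ S₁) u v))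
    (union-small (proj₁ S₀) (proj₁ S₁) (small 0F (λ _ _ → false) (B 0F) S₀) (small 1F (proj₁ S₀) (B 1F) S₁)) (B 2F))

  classify₀ : Selection 0F (λ _ _ → false) (B 0F) → Classification
  classify₀ S₀ = classify₁ S₀ (stage 1F (λ ()) (proj₁ S₀) (proj₁ (proj₂ S₀))
    (λ v → ≤-trans (small 0F (λ _ _ → false) (B 0F) S₀ v) (m≤m+n (d + 4 * M) (d + 4 * M + 0))) (B 1F))

  abstract
    classification : Classification
    classification = classify₀ (stage 0F (λ ()) (λ _ _ → false) (λ _ _ → refl)
      (λ v → ≤-trans (≤-reflexive (cong (4 *_) (sum-zero {n} {λ _ → 0} (λ _ → refl)))) z≤n) (B 0F))

-- From the edge colouring to the partition of the graph.

count-tabulate : ∀ {A : Set} {P : A → Set} (P? : ∀ a → Dec (P a)) (f : Fin n → A) →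
                 count P? (tabulate f) ≡ # (λ i → does (P? (f i)))
count-tabulate {zero}  P? f = refl
count-tabulate {suc n} P? f with does (P? (f zero))
... | true  = cong suc (count-tabulate P? (f ∘ suc))
... | false = count-tabulate P? (f ∘ suc)

theorem4 : ∀ (d : ℕ) → d ≥ 54000 → ∀ (n : ℕ) (G : Graph n) → Regular d G → Decomposable 4 G
theorem4 d d≥54000 n G regular = decompose (cube-root (2 * d))
  where
  E : Fin n → Fin n → Bool
  E u v = does (Graph.adj? G u v)
  E-sym : Symmetricᵇ E
  E-sym u v = does-cong (Graph.adj? G u v) (Graph.adj? G v u) (Graph.sym G) (Graph.sym G)
  loopless : Looplessᵇ E
  loopless v with Graph.adj? G v v
  ... | yes loop = ⊥-elim (Graph.irrefl G refl loop)
  ... | no _     = refl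
  #E : ∀ v → # (E v) ≡ d
  #E v = trans (sym (count-tabulate (Graph.adj? G v) (λ u → u))) (regular v)

  module Parts (χ : Fin n → Fin n → Fin 4) (χ-sym : ∀ u v → χ u v ≡ χ v u)
    (irregular : ∀ u v → E u v ≡ true →
       # (λ w → E u w ∧ is (χ u v) (χ u w)) ≢ # (λ w → E v w ∧ is (χ u v) (χ v w))) where

    part : Fin 4 → Graph n
    part i = record
      { Adj    = λ u v → Adj G u v × χ u v ≡ i
      ; adj?   = λ u v → Graph.adj? G u v ×-dec (χ u v ≟ i)
      ; sym    = λ { {u} {v} (uv , eq) → Graph.sym G uv , trans (χ-sym v u) eq }
      ; irrefl = λ { u≡v (uv , _) → Graph.irrefl G u≡v uv }
      }

    partition : EdgePartition 4 G
    partition = record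
      { part     = part
      ; subgraph = λ i → proj₁
      ; covers   = λ u v uv → χ u v , uv , refl
      ; disjoint = λ i j i≢j u v (_ , eq) (_ , eq′) → i≢j (trans (sym eq) eq′)
      }

    part-irregular : ∀ i → LocallyIrregular (part i)
    part-irregular i u v (uv , refl) same = irregular u v (true-does (Graph.adj? G u v) uv)
      (trans (sym (degree≡ u)) (trans same (degree≡ v)))
      where
      degree≡ : ∀ w → degree (part i) w ≡ # (λ t → E w t ∧ is i (χ w t))
      degree≡ w = count-tabulate (Graph.adj? (part i) w) (λ t → t)

  from-classes : (∃ λ (χ : Fin n → Fin n → Fin 4) → (∀ u v → χ u v ≡ χ v u) ×
    (∀ u v → E u v ≡ true →
       # (λ w → E u w ∧ is (χ u v) (χ u w)) ≢ # (λ w → E v w ∧ is (χ u v) (χ v w)))) → Decomposable 4 G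
  from-classes (χ , χ-sym , irregular) = partition , part-irregular
    where open Parts χ χ-sym irregular

  from-colouring : ∀ j → 8 * (suc j * suc j) + 700 * suc j ≤ d →
    (∃ λ (c : Fin n → Palette.Colour (suc j)) →
       ∀ v → sum (λ u → ⟦ E v u ⟧ * Palette.cost (suc j) (c v) (c u)) < 4 * (suc j * suc j)) →
    Decomposable 4 G
  from-colouring j bound (c , cheap) =
    from-classes (Stages.classification E E-sym loopless d #E j bound c cheap)

  decompose : (∃ λ j → cube j ≤ 2 * d × 2 * d < cube (suc j)) → Decomposable 4 G
  -- The modulus `suc j` is the least whose cube exceeds `2 * d`: `hi` gives the averaging bound for
  -- the colouring, and `lo` keeps the modulus small compared with `d`.
  decompose (j , lo , hi) = from-colouring j (degree-bound d d≥54000 j lo hi)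
    (Palette.cheap-colouring (suc j) E E-sym loopless
      (λ v → subst (λ e → 2 * e < cube (suc j)) (sym (#E v)) hi) (zero , zero , zero))
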